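{- Let $G=(V,E)$ be a finite undirected graph with edge weights $w:E\to[0,1]$. Let $APX_{FC}$ be the forest cover returned by the LP-rounding algorithm on $G$ and $OPT_{FC}$ a forest cover of $G$ of minimum weighted index. Then $wi(OPT_{FC})\ge \frac12\, wi(APX_{FC})$.
   Context: A forest cover of $G$ is a forest $F$ in $G$ (acyclic subgraph with vertex set $V_F$ and edge set $E_F$; isolated vertices allowed) whose vertex set is a vertex cover of $G$; its weighted index is $wi(F)=\sum_{e\in E_F}w_e+c_F$, where $c_F$ is the number of connected components of $F$. FC-LP is the linear program: minimize $\sum_{i\in V}x_i-\sum_{(i,j)\in E}y_{ij}(1-w_{ij})$ subject to $x_i+x_j\ge1$ for all $(i,j)\in E$; $x_i\ge y_{ij}$, $x_j\ge y_{ij}$ for all $(i,j)\in E$; $\sum_{i\in S}x_i-\sum_{(i,j)\in E(S)}y_{ij}\ge1$ for all $S\subseteq V$ with $E(S)\ne\emptyset$, where $E(S)$ is the set of edges with both endpoints in $S$; $0\le x_i,y_{ij}\le1$. LP-rounding algorithm: (1) compute an optimal solution $(x^*,y^*)$ of FC-LP; (2) let $G^*$ have vertex set $\{i\in V:x^*_i>0\}$ and edge set $\{(i,j)\in E:y^*_{ij}>0\}$; (3) let $\hat C$ be the set of vertices of $G^*$ with no incident edge in $G^*$ and $\hat C^A=\{i\in\hat C:x^*_i\ge1/2\}$; (4) for each connected component $C=(V_C,E_C)$ of $G^*$ with at least one edge, compute a minimum spanning tree $M$ of $C$ (with respect to $w$) by Kruskal's algorithm, let $V_D$ be the set of pendant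 (degree-one) vertices $i$ of $M$ with $x^*_i<1/2$, let $E_D$ be the set of edges of $M$ incident to $V_D$, and let $T$ be the tree obtained from $M$ by deleting $V_D$ and $E_D$; (5) return the forest $F$ consisting of all these trees $T$ and the isolated vertices of $\hat C^A$.
   Formalization: The edge weights w and the optimal solution (x*, y*) of FC-LP are taken to be rational rather than real, with optimality measured against rational feasible points. -}

module Defs where

open import Data.Bool using (Bool; true; false; _∧_; _∨_; not; if_then_else_)
open import Data.Nat as ℕ using (ℕ; zero; suc)
open import Data.Fin as Fin using (Fin)
open import Data.Integer using (+_)
open import Data.Rational using (ℚ; 0ℚ; 1ℚ; ½; _+_; _-_; _*_; _≤_; _<_; _/_)
open import Data.Rational.Properties using (_<?_; _≤?_)
open import Data.List using (List; []; _∷_; _++_; [_]; length)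
open import Data.List.Relation.Unary.Linked using (Linked)
open import Data.List.Relation.Unary.Unique.Propositional using (Unique)
open import Data.Product using (Σ; Σ-syntax; ∃; _×_; _,_)
open import Data.Sum using (_⊎_)
open import Relation.Nullary using (¬_; does)
open import Relation.Binary.PropositionalEquality using (_≡_; _≢_)
open import Relation.Binary.Construct.Closure.ReflexiveTransitive using (Star)

sumℚ : {k : ℕ} → (Fin k → ℚ) → ℚ
sumℚ {zero}  f = 0ℚ
sumℚ {suc k} f = f Fin.zero + sumℚ (λ i → f (Fin.suc i))

sumℕ : {k : ℕ} → (Fin k → ℕ) → ℕ
sumℕ {zero}  f = 0
sumℕ {suc k} f = f Fin.zero ℕ.+ sumℕ (λ i → f (Fin.suc i))

anyF : {k : ℕ} → (Fin k → Bool) → Bool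
anyF {zero}  f = false
anyF {suc k} f = f Fin.zero ∨ anyF (λ i → f (Fin.suc i))

ℕtoℚ : ℕ → ℚ
ℕtoℚ k = (+ k) / 1

record Graph : Set where
  field
    n   : ℕ
    m   : ℕ
    src : Fin m → Fin n
    tgt : Fin m → Fin n
    loopless : ∀ e → src e ≢ tgt e
    simple   : ∀ e e' →
               ((src e ≡ src e' × tgt e ≡ tgt e') ⊎ (src e ≡ tgt e' × tgt e ≡ src e'))
               → e ≡ e'

module _ (G : Graph) where
  open Graph G

  incident : Fin m → Fin n → Bool
  incident e i = does (src e Fin.≟ i) ∨ does (tgt e Fin.≟ i)

  record Sub : Set where
    constructor ⟨_,_⟩
    field
      vs : Fin n → Bool
      es : Fin m → Bool
  open Sub public

  WellFormed : Sub → Set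
  WellFormed F = ∀ e → es F e ≡ true → vs F (src e) ≡ true × vs F (tgt e) ≡ true

  Adj : Sub → Fin n → Fin n → Set
  Adj F u v = Σ[ e ∈ Fin m ] (es F e ≡ true ×
                ((src e ≡ u × tgt e ≡ v) ⊎ (src e ≡ v × tgt e ≡ u)))

  Reach : Sub → Fin n → Fin n → Set
  Reach F = Star (Adj F)

  Cycle : Sub → Set
  Cycle F = Σ[ v ∈ Fin n ] Σ[ ws ∈ List (Fin n) ]
              (2 ℕ.≤ length ws × Unique (v ∷ ws) × Linked (Adj F) (v ∷ ws ++ [ v ]))

  IsForest : Sub → Set
  IsForest F = WellFormed F × ¬ Cycle F

  -- F has exactly k connected components: a labelling of the vertices of F
  -- by Fin k, identifying exactly the mutually reachable vertices, onto Fin k.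
  NumComponents : Sub → ℕ → Set
  NumComponents F k =
    Σ[ f ∈ (Fin n → Fin k) ]
      ((∀ u v → vs F u ≡ true → vs F v ≡ true →
          (f u ≡ f v → Reach F u v) × (Reach F u v → f u ≡ f v))
      × (∀ c → Σ[ v ∈ Fin n ] (vs F v ≡ true × f v ≡ c)))

  IsVertexCover : (Fin n → Bool) → Set
  IsVertexCover C = ∀ e → C (src e) ≡ true ⊎ C (tgt e) ≡ true

  IsForestCover : Sub → Set
  IsForestCover F = IsForest F × IsVertexCover (vs F)

  module _ (w : Fin m → ℚ) where

    edgeWeight : (Fin m → Bool) → ℚ
    edgeWeight S = sumℚ (λ e → if S e then w e else 0ℚ)

    WeightedIndex : Sub → ℚ → Set
    WeightedIndex F q = Σ[ k ∈ ℕ ] (NumComponents F k × q ≡ edgeWeight (es F) + ℕtoℚ k)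

    IsMinimumForestCover : Sub → Set
    IsMinimumForestCover F =
      IsForestCover F ×
      (∀ F' a a' → IsForestCover F' → WeightedIndex F a → WeightedIndex F' a' → a ≤ a')

    inducedEdge : (Fin n → Bool) → Fin m → Bool
    inducedEdge S e = S (src e) ∧ S (tgt e)

    Feasible : (Fin n → ℚ) → (Fin m → ℚ) → Set
    Feasible x y =
      (∀ e → 1ℚ ≤ x (src e) + x (tgt e))
      × (∀ e → y e ≤ x (src e) × y e ≤ x (tgt e))
      × (∀ (S : Fin n → Bool) → (Σ[ e ∈ Fin m ] inducedEdge S e ≡ true) →
           1ℚ ≤ sumℚ (λ i → if S i then x i else 0ℚ)
                - sumℚ (λ e → if inducedEdge S e then y e else 0ℚ))
      × (∀ i → 0ℚ ≤ x i × x i ≤ 1ℚ)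
      × (∀ e → 0ℚ ≤ y e × y e ≤ 1ℚ)

    objective : (Fin n → ℚ) → (Fin m → ℚ) → ℚ
    objective x y = sumℚ x - sumℚ (λ e → y e * (1ℚ - w e))

    Optimal : (Fin n → ℚ) → (Fin m → ℚ) → Set
    Optimal x y = Feasible x y ×
      (∀ x' y' → Feasible x' y' → objective x y ≤ objective x' y')

    module _ (x : Fin n → ℚ) (y : Fin m → ℚ) where

      Vstar : Fin n → Bool
      Vstar i = does (0ℚ <? x i)

      Estar : Fin m → Bool
      Estar e = does (0ℚ <? y e)

      Gstar : Sub
      Gstar = ⟨ Vstar , Estar ⟩

      hasEdgeStar : Fin n → Bool
      hasEdgeStar i = anyF (λ e → Estar e ∧ incident e i)

      Chat : Fin n → Bool
      Chat i = Vstar i ∧ not (hasEdgeStar i)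

      ChatA : Fin n → Bool
      ChatA i = Chat i ∧ does (½ ≤? x i)

      IsEdgeComponent : (Fin n → Bool) → Set
      IsEdgeComponent K =
        (∀ u → K u ≡ true → Vstar u ≡ true)
        × (∀ u v → K u ≡ true → K v ≡ true → Reach Gstar u v)
        × (∀ u v → K u ≡ true → Reach Gstar u v → K v ≡ true)
        × (Σ[ e ∈ Fin m ] (Estar e ≡ true × K (src e) ≡ true))

      IsSpanningTree : (Fin n → Bool) → (Fin m → Bool) → Set
      IsSpanningTree K T =
        (∀ e → T e ≡ true → Estar e ≡ true × K (src e) ≡ true × K (tgt e) ≡ true)
        × ¬ Cycle ⟨ K , T ⟩
        × (∀ u v → K u ≡ true → K v ≡ true → Reach ⟨ K , T ⟩ u v)

      IsMST : (Fin n → Bool) → (Fin m → Bool) → Set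
      IsMST K T = IsSpanningTree K T ×
        (∀ T' → IsSpanningTree K T' → edgeWeight T ≤ edgeWeight T')

      -- M (edge set) is the union of the chosen minimum spanning trees,
      -- one for each component of G* with at least one edge
      MSTChoice : (Fin m → Bool) → Set
      MSTChoice M =
        (∀ e → M e ≡ true → Estar e ≡ true)
        × (∀ K → IsEdgeComponent K → IsMST K (λ e → M e ∧ K (src e)))

      module _ (M : Fin m → Bool) where

        degM : Fin n → ℕ
        degM i = sumℕ (λ e → if M e ∧ incident e i then 1 else 0)

        VD : Fin n → Bool
        VD i = does (degM i ℕ.≟ 1) ∧ does (x i <? ½)

        ED : Fin m → Bool
        ED e = M e ∧ (VD (src e) ∨ VD (tgt e))

        APX : Sub
        APX = ⟨ (λ i → (Vstar i ∧ hasEdgeStar i ∧ not (VD i)) ∨ ChatA i)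
              , (λ e → M e ∧ not (ED e)) ⟩

{-# OPTIONS --safe #-}
module Submission where

-- The indicator of a forest cover is LP-feasible with objective at most its weighted
-- index, so it suffices to bound twice the LP value below by |V(APX)| − Σ (1 − w e) over
-- the edges of APX.  Both sides are affine in c = 1 − w, so by a layer-cake argument it is
-- enough to treat the superlevel sets H of c.  For such an H, minimality of M makes every
-- edge of G* in H join vertices of one component of M ∩ H; the subset constraints then
-- give 1 for every component with an edge, while an isolated vertex i contributes x i.
-- Isolated vertices with x i < ½ that survive the pruning have degree at least two in M,
-- and their neighbours j have x j ≥ 1 − x i; peeling the leaves of the forest M shows that
-- the surplus of the other components pays for their deficit.

open import Defs
open import Data.Bool using (Bool; true; false; _∧_; _∨_; not; if_then_else_)
open import Data.Bool.Properties using (∧-identityʳ) renaming (_≟_ to _≟ᵇ_)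
open import Data.Empty using (⊥; ⊥-elim)
open import Data.Fin using (Fin; zero; suc; _≟_)
open import Data.Fin.Properties using (any?; suc-injective)
import Data.Integer as ℤ
import Data.Integer.Properties as ℤ
open import Data.List using (List; []; _∷_; _++_; [_])
open import Data.List.Membership.DecPropositional using (_∈?_)
open import Data.List.Membership.Propositional using (_∈_)
open import Data.List.Relation.Unary.All as All using (All)
open import Data.List.Relation.Unary.All.Properties using (¬Any⇒All¬)
open import Data.List.Relation.Unary.AllPairs as AllPairs using ()
open import Data.List.Relation.Unary.Any using (here; there)
open import Data.List.Relation.Unary.Linked as Linked using (Linked; [-])
open import Data.List.Relation.Unary.Unique.Propositional using (Unique)
open import Data.Maybe using (Maybe; just; nothing)
open import Data.Nat as ℕ using (ℕ; zero; suc; z≤n; s≤s)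
import Data.Nat.Properties as ℕ
open import Data.Product using (Σ-syntax; ∃; _×_; _,_; proj₁; proj₂)
open import Data.Rational using (ℚ; 0ℚ; 1ℚ; ½; _+_; _-_; _*_; -_; _≤_; _<_; nonNegative)
import Data.Rational.Properties as ℚ
open import Data.Rational.Unnormalised using (*≡*; mkℚᵘ) renaming (_+_ to _+ᵘ_; _≃_ to _≃ᵘ_)
open import Data.Rational.Unnormalised.Properties using (≃-trans; ≃-sym; +-cong)
open import Data.Sum using (_⊎_; inj₁; inj₂)
open import Function using (_∘_; case_of_; mk⇔)
open import Level using (0ℓ)
open import Relation.Binary.Construct.Closure.ReflexiveTransitive as Star using (Star; ε; _◅_; _◅◅_)
open import Relation.Binary.PropositionalEquality using (_≡_; _≢_; refl; sym; trans; cong; cong₂; subst)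
open import Relation.Nullary using (¬_; Dec; yes; no; does)
open import Relation.Nullary.Decidable using (dec-true; dec-false; _×-dec_; ¬?; does-⇔)
open import Tactic.RingSolver using (solve)
open import Tactic.RingSolver.Core.AlmostCommutativeRing using (AlmostCommutativeRing; fromCommutativeRing)

-- The obstacle is that the objective discounts an edge by `1 - w e` while the subset constraints
-- count all edges alike. On a superlevel set the discount is 0 or 1, so the constraints can be
-- summed there. One `M` serves every level because a minimum spanning tree joins the ends of an
-- edge of `G*` by edges no heavier than it. At one level the LP value is at least `sumℚ ρ - # MH`
-- and the cost of `APX` at most `sumℚ σ - # MH`, so the factor 2 follows once `# MH` is at most the
-- sum of `val`, which is twice `ρ` minus `σ`. The threshold ½ is the zero of `2x - 1`, a lower
-- bound for `val`: the covering constraints make these bounds sum to at least 0 along every edge. A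
-- heavy vertex might still have to pay for many light pendant neighbours; pruning rules this out,
-- since it leaves every pendant vertex of `M` with a nonnegative value. Component counts enter only
-- as vertices minus edges: a graph has at least that many components, with equality for forests.

-- Rational inequalities and Boolean reasoning.

ℚ-ring : AlmostCommutativeRing 0ℓ 0ℓ
ℚ-ring = fromCommutativeRing ℚ.+-*-commutativeRing isZero
  where
  isZero : ∀ q → Maybe (0ℚ ≡ q)
  isZero q with 0ℚ ℚ.≟ q
  ... | yes 0≡q = just 0≡q
  ... | no  _   = nothing

-- Linear inequalities are proved by exhibiting the gap between the two sides
-- as a sum of gaps of known inequalities.
gap : ∀ {p q} → p ≤ q → 0ℚ ≤ q - p
gap {p} {q} p≤q = subst (_≤ q - p) (ℚ.+-inverseʳ p) (ℚ.+-monoˡ-≤ (- p) p≤q)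

infixl 6 _⊕_
_⊕_ : ∀ {p q} → 0ℚ ≤ p → 0ℚ ≤ q → 0ℚ ≤ p + q
_⊕_ = ℚ.+-mono-≤

by-gap : ∀ {p q d} → 0ℚ ≤ d → q - p ≡ d → p ≤ q
by-gap {p} {q} {d} 0≤d eq = subst (p ≤_) p+d≡q (subst (_≤ p + d) (ℚ.+-identityʳ p) (ℚ.+-monoʳ-≤ p 0≤d))
  where
  p+d≡q : p + d ≡ q
  p+d≡q = trans (cong (p +_) (sym eq)) (solve (p ∷ q ∷ []) ℚ-ring)

0≤1 : 0ℚ ≤ 1ℚ
0≤1 = ℚ.nonNegative⁻¹ 1ℚ

1≰0 : ¬ 1ℚ ≤ 0ℚ
1≰0 1≤0 = ℚ.1≢0 (ℚ.≤-antisym 1≤0 0≤1)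

*-nonneg : ∀ {p q} → 0ℚ ≤ p → 0ℚ ≤ q → 0ℚ ≤ p * q
*-nonneg {p} {q} 0≤p 0≤q =
  subst (_≤ p * q) (ℚ.*-zeroʳ p) (ℚ.*-monoˡ-≤-nonNeg p {{nonNegative 0≤p}} 0≤q)

holds : ∀ {P : Set} (P? : Dec P) → does P? ≡ true → P
holds (yes p) _ = p

fails : ∀ {P : Set} (P? : Dec P) → does P? ≡ false → ¬ P
fails (no ¬p) _ = ¬p

∧-true : ∀ {a b} → a ∧ b ≡ true → a ≡ true × b ≡ true
∧-true {true} {true} _ = refl , refl

∧-intro : ∀ {a b} → a ≡ true → b ≡ true → a ∧ b ≡ true
∧-intro refl refl = refl

∨-true : ∀ {a b} → a ∨ b ≡ true → a ≡ true ⊎ b ≡ true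
∨-true {true}  _ = inj₁ refl
∨-true {false} b = inj₂ b

∨-introˡ : ∀ {a b} → a ≡ true → a ∨ b ≡ true
∨-introˡ refl = refl

∨-introʳ : ∀ {a b} → b ≡ true → a ∨ b ≡ true
∨-introʳ {true}  _ = refl
∨-introʳ {false} b = b

not-true : ∀ {a} → not a ≡ true → a ≡ false
not-true {false} _ = refl

true≢false : ∀ {a} → a ≡ true → a ≡ false → ⊥
true≢false refl ()

≢true : ∀ {a} → ¬ a ≡ true → a ≡ false
≢true {true}  ¬a = ⊥-elim (¬a refl)
≢true {false} _  = refl

anyF-true : ∀ {k} (f : Fin k → Bool) → anyF f ≡ true → ∃ λ i → f i ≡ true
anyF-true {suc k} f eq with ∨-true {f zero} eq
... | inj₁ f0 = zero , f0
... | inj₂ fs with anyF-true (f ∘ suc) fs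
...   | i , fi = suc i , fi

anyF-intro : ∀ {k} (f : Fin k → Bool) i → f i ≡ true → anyF f ≡ true
anyF-intro f zero    fi = ∨-introˡ fi
anyF-intro f (suc i) fi = ∨-introʳ {f zero} (anyF-intro (f ∘ suc) i fi)

-- Finite sums

Σ-cong : ∀ {k} {f g : Fin k → ℚ} → (∀ i → f i ≡ g i) → sumℚ f ≡ sumℚ g
Σ-cong {zero}  f≡g = refl
Σ-cong {suc k} f≡g = cong₂ _+_ (f≡g zero) (Σ-cong (f≡g ∘ suc))

Σ-mono : ∀ {k} {f g : Fin k → ℚ} → (∀ i → f i ≤ g i) → sumℚ f ≤ sumℚ g
Σ-mono {zero}  f≤g = ℚ.≤-refl
Σ-mono {suc k} f≤g = ℚ.+-mono-≤ (f≤g zero) (Σ-mono (f≤g ∘ suc))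

Σ-zero : ∀ {k} {f : Fin k → ℚ} → (∀ i → f i ≡ 0ℚ) → sumℚ f ≡ 0ℚ
Σ-zero {zero}  f≡0 = refl
Σ-zero {suc k} f≡0 = cong₂ _+_ (f≡0 zero) (Σ-zero (f≡0 ∘ suc))

Σ-nonneg : ∀ {k} {f : Fin k → ℚ} → (∀ i → 0ℚ ≤ f i) → 0ℚ ≤ sumℚ f
Σ-nonneg {k} {f} 0≤f = subst (_≤ sumℚ f) (Σ-zero {k} (λ _ → refl)) (Σ-mono 0≤f)

Σ-+ : ∀ {k} (f g : Fin k → ℚ) → sumℚ (λ i → f i + g i) ≡ sumℚ f + sumℚ g
Σ-+ {zero}  f g = refl
Σ-+ {suc k} f g = trans (cong (f zero + g zero +_) (Σ-+ (f ∘ suc) (g ∘ suc)))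
  (interchange (f zero) (g zero) (sumℚ (f ∘ suc)) (sumℚ (g ∘ suc)))
  where
  interchange : ∀ a b c d → (a + b) + (c + d) ≡ (a + c) + (b + d)
  interchange a b c d = solve (a ∷ b ∷ c ∷ d ∷ []) ℚ-ring

Σ-* : ∀ {k} c (f : Fin k → ℚ) → sumℚ (λ i → c * f i) ≡ c * sumℚ f
Σ-* {zero}  c f = sym (ℚ.*-zeroʳ c)
Σ-* {suc k} c f = trans (cong (c * f zero +_) (Σ-* c (f ∘ suc)))
  (sym (ℚ.*-distribˡ-+ c (f zero) (sumℚ (f ∘ suc))))

Σ-- : ∀ {k} (f g : Fin k → ℚ) → sumℚ (λ i → f i - g i) ≡ sumℚ f - sumℚ g
Σ-- f g = trans (Σ-cong (λ i → minus (f i) (g i)))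
  (trans (Σ-+ f (λ i → - 1ℚ * g i)) (trans (cong (sumℚ f +_) (Σ-* (- 1ℚ) g)) (sym (minus (sumℚ f) (sumℚ g)))))
  where
  minus : ∀ a b → a - b ≡ a + - 1ℚ * b
  minus a b = solve (a ∷ b ∷ []) ℚ-ring

Σ-comm : ∀ {k l} (f : Fin k → Fin l → ℚ) →
  sumℚ (λ i → sumℚ (λ j → f i j)) ≡ sumℚ (λ j → sumℚ (λ i → f i j))
Σ-comm {zero} {l} f = sym (Σ-zero {l} (λ _ → refl))
Σ-comm {suc k} f = trans (cong (sumℚ (f zero) +_) (Σ-comm (f ∘ suc)))
  (sym (Σ-+ (f zero) (λ j → sumℚ (λ i → f (suc i) j))))

Σ-point : ∀ {k} j (f : Fin k → ℚ) → sumℚ (λ i → if does (j ≟ i) then f i else 0ℚ) ≡ f j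
Σ-point {suc k} zero f = trans (cong (f zero +_) (Σ-zero {k} (λ _ → refl))) (ℚ.+-identityʳ _)
Σ-point (suc j) f = trans (ℚ.+-identityˡ _) (Σ-point j (f ∘ suc))

Σ-fibre : ∀ {k l} (g : Fin k → Fin l) (f : Fin k → ℚ) →
  sumℚ f ≡ sumℚ (λ c → sumℚ (λ i → if does (g i ≟ c) then f i else 0ℚ))
Σ-fibre g f = trans (Σ-cong (λ i → sym (Σ-point (g i) (λ _ → f i)))) 
  (Σ-comm (λ i c → if does (g i ≟ c) then f i else 0ℚ))

Σ-term : ∀ {k} {f : Fin k → ℚ} → (∀ i → 0ℚ ≤ f i) → ∀ j → f j ≤ sumℚ f
Σ-term {f = f} 0≤f j = subst (_≤ sumℚ f) (Σ-point j f) (Σ-mono below)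
  where
  below : ∀ i → (if does (j ≟ i) then f i else 0ℚ) ≤ f i
  below i with does (j ≟ i)
  ... | true  = ℚ.≤-refl
  ... | false = 0≤f i

-- Cardinalities of decidable subsets

⟦_⟧ : Bool → ℚ
⟦ b ⟧ = if b then 1ℚ else 0ℚ

# : ∀ {k} → (Fin k → Bool) → ℚ
# S = sumℚ (λ i → ⟦ S i ⟧)

⟦⟧≥0 : ∀ b → 0ℚ ≤ ⟦ b ⟧
⟦⟧≥0 true  = 0≤1
⟦⟧≥0 false = ℚ.≤-refl

⟦⟧≤1 : ∀ b → ⟦ b ⟧ ≤ 1ℚ
⟦⟧≤1 true  = ℚ.≤-refl
⟦⟧≤1 false = 0≤1

⟦⟧-mono : ∀ {a b} → (a ≡ true → b ≡ true) → ⟦ a ⟧ ≤ ⟦ b ⟧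
⟦⟧-mono {true}  {b} a⇒b rewrite a⇒b refl = ℚ.≤-refl
⟦⟧-mono {false} {b} a⇒b = ⟦⟧≥0 b

⟦⟧-not : ∀ b → ⟦ b ⟧ + ⟦ not b ⟧ ≡ 1ℚ
⟦⟧-not true  = refl
⟦⟧-not false = refl

when-nonneg : ∀ b {q} → 0ℚ ≤ q → 0ℚ ≤ (if b then q else 0ℚ)
when-nonneg true  0≤q = 0≤q
when-nonneg false _   = ℚ.≤-refl

if-true : ∀ {A : Set} {b} {p q : A} → b ≡ true → (if b then p else q) ≡ p
if-true refl = refl

if-false : ∀ {A : Set} {b} {p q : A} → b ≡ false → (if b then p else q) ≡ q
if-false refl = refl

-- The quotient in `ℕtoℚ` is normalised and does not compute for a variable `k`; on unnormalised
-- fractions the identity is a single integer equation.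
ℕtoℚ-suc : ∀ k → ℕtoℚ (suc k) ≡ 1ℚ + ℕtoℚ k
ℕtoℚ-suc k = ℚ.toℚᵘ-injective (≃-trans (ℚ.toℚᵘ-fromℚᵘ (mkℚᵘ (ℤ.+ suc k) 0))
  (≃-trans 1+k (≃-sym (≃-trans (ℚ.toℚᵘ-homo-+ 1ℚ (ℕtoℚ k))
    (+-cong {mkℚᵘ (ℤ.+ 1) 0} {mkℚᵘ (ℤ.+ 1) 0} (*≡* refl) (ℚ.toℚᵘ-fromℚᵘ (mkℚᵘ (ℤ.+ k) 0)))))))
  where
  1+k : mkℚᵘ (ℤ.+ suc k) 0 ≃ᵘ (mkℚᵘ (ℤ.+ 1) 0 +ᵘ mkℚᵘ (ℤ.+ k) 0)
  1+k = *≡* (cong (λ z → (ℤ.+ 1 ℤ.+ z) ℤ.* ℤ.+ 1) (sym (ℤ.*-identityʳ (ℤ.+ k))))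

Σ-one : ∀ k → sumℚ {k} (λ _ → 1ℚ) ≡ ℕtoℚ k
Σ-one zero    = refl
Σ-one (suc k) = trans (cong (1ℚ +_) (Σ-one k)) (sym (ℕtoℚ-suc k))

-- Sum over the fibres of `g`: each contains at most one element of `P`, and none unless it lies
-- over `Q`.
#-injection : ∀ {k l} {P : Fin k → Bool} {Q : Fin l → Bool} (g : Fin k → Fin l) →
  (∀ i → P i ≡ true → Q (g i) ≡ true) →
  (∀ i j → P i ≡ true → P j ≡ true → g i ≡ g j → i ≡ j) → # P ≤ # Q
#-injection {P = P} {Q} g maps inj = ℚ.≤-trans (ℚ.≤-reflexive (Σ-fibre g _)) (Σ-mono fibre)
  where
  fibre : ∀ c → sumℚ (λ i → if does (g i ≟ c) then ⟦ P i ⟧ else 0ℚ) ≤ ⟦ Q c ⟧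
  fibre c with any? (λ i → (P i ≟ᵇ true) ×-dec (g i ≟ c))
  ... | no none = ℚ.≤-trans (ℚ.≤-reflexive (Σ-zero empty)) (⟦⟧≥0 _)
    where
    empty : ∀ i → (if does (g i ≟ c) then ⟦ P i ⟧ else 0ℚ) ≡ 0ℚ
    empty i with g i ≟ c | P i in Pi
    ... | no _    | _     = refl
    ... | yes _   | false = refl
    ... | yes gi  | true  = ⊥-elim (none (i , Pi , gi))
  ... | yes (j , Pj , refl) rewrite maps j Pj =
        ℚ.≤-trans (Σ-mono single) (ℚ.≤-reflexive (Σ-point j (λ _ → 1ℚ)))
    where
    single : ∀ i → (if does (g i ≟ g j) then ⟦ P i ⟧ else 0ℚ) ≤ ⟦ does (j ≟ i) ⟧
    single i with g i ≟ g j | P i in Pi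
    ... | no _    | _     = ⟦⟧≥0 _
    ... | yes _   | false = ⟦⟧≥0 _
    ... | yes gi  | true rewrite dec-true (j ≟ i) (inj j i Pj Pi (sym gi)) = ℚ.≤-refl

#-complement : ∀ {k} (S : Fin k → Bool) → # S + # (not ∘ S) ≡ sumℚ {k} (λ _ → 1ℚ)
#-complement S = trans (sym (Σ-+ (⟦_⟧ ∘ S) _)) (Σ-cong (λ i → ⟦⟧-not (S i)))

-- Removing and adding an element

infixl 7 _∖_ _∪_
_∖_ _∪_ : ∀ {k} → (Fin k → Bool) → Fin k → (Fin k → Bool)
(S ∖ i) j = S j ∧ not (does (i ≟ j))
(S ∪ i) j = S j ∨ does (i ≟ j)

∖-intro : ∀ {k} (S : Fin k → Bool) {i j} → S j ≡ true → i ≢ j → (S ∖ i) j ≡ true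
∖-intro S {i} {j} Sj i≢j = ∧-intro Sj (cong not (dec-false (i ≟ j) i≢j))

∖-elim : ∀ {k} (S : Fin k → Bool) {i j} → (S ∖ i) j ≡ true → S j ≡ true × i ≢ j
∖-elim S {i} {j} eq with ∧-true {S j} eq
... | Sj , ne = Sj , fails (i ≟ j) (not-true ne)

∪-elim : ∀ {k} (S : Fin k → Bool) {i j} → (S ∪ i) j ≡ true → S j ≡ true ⊎ i ≡ j
∪-elim S {i} {j} eq with ∨-true {S j} eq
... | inj₁ Sj = inj₁ Sj
... | inj₂ ij = inj₂ (holds (i ≟ j) ij)

∪-new : ∀ {k} (S : Fin k → Bool) i → (S ∪ i) i ≡ true
∪-new S i = ∨-introʳ {S i} (dec-true (i ≟ i) refl)

Σ-remove : ∀ {k} (S : Fin k → Bool) (f : Fin k → ℚ) i → S i ≡ true →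
  sumℚ (λ j → if (S ∖ i) j then f j else 0ℚ) + f i ≡ sumℚ (λ j → if S j then f j else 0ℚ)
Σ-remove S f i Si = trans (cong (sumℚ (λ j → if (S ∖ i) j then f j else 0ℚ) +_) (sym (Σ-point i f)))
  (trans (sym (Σ-+ (λ j → if (S ∖ i) j then f j else 0ℚ) (λ j → if does (i ≟ j) then f j else 0ℚ)))
         (Σ-cong pointwise))
  where
  pointwise : ∀ j → (if (S ∖ i) j then f j else 0ℚ) + (if does (i ≟ j) then f j else 0ℚ)
                    ≡ (if S j then f j else 0ℚ)
  pointwise j with i ≟ j | S j in Sj
  ... | yes refl | true  = ℚ.+-identityˡ (f j)
  ... | yes refl | false = ⊥-elim (true≢false Si Sj)
  ... | no _     | true  = ℚ.+-identityʳ (f j)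
  ... | no _     | false = refl

Σ-add : ∀ {k} (S : Fin k → Bool) (f : Fin k → ℚ) i → S i ≡ false →
  sumℚ (λ j → if (S ∪ i) j then f j else 0ℚ) ≡ sumℚ (λ j → if S j then f j else 0ℚ) + f i
Σ-add S f i Si = trans (trans (Σ-cong pointwise)
  (Σ-+ (λ j → if S j then f j else 0ℚ) (λ j → if does (i ≟ j) then f j else 0ℚ)))
  (cong (sumℚ (λ j → if S j then f j else 0ℚ) +_) (Σ-point i f))
  where
  pointwise : ∀ j → (if (S ∪ i) j then f j else 0ℚ)
                    ≡ (if S j then f j else 0ℚ) + (if does (i ≟ j) then f j else 0ℚ)
  pointwise j with i ≟ j | S j in Sj
  ... | yes refl | true  = ⊥-elim (true≢false Sj Si)
  ... | yes refl | false = sym (ℚ.+-identityˡ (f j))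
  ... | no _     | true  = sym (ℚ.+-identityʳ (f j))
  ... | no _     | false = refl

card : ∀ {k} → (Fin k → Bool) → ℕ
card S = sumℕ (λ i → if S i then 1 else 0)

card-mono : ∀ {k} {S T : Fin k → Bool} → (∀ i → S i ≡ true → T i ≡ true) → card S ℕ.≤ card T
card-mono {zero}  S⊆T = z≤n
card-mono {suc k} {S} {T} S⊆T = ℕ.+-mono-≤ head (card-mono (S⊆T ∘ suc))
  where
  head : (if S zero then 1 else 0) ℕ.≤ (if T zero then 1 else 0)
  head with S zero in S0
  ... | false = z≤n
  ... | true rewrite S⊆T zero S0 = ℕ.≤-refl

card-remove : ∀ {k} (S : Fin k → Bool) i → S i ≡ true → card (S ∖ i) ℕ.< card S
card-remove S zero    Si rewrite Si =
  s≤s (card-mono {S = (S ∖ zero) ∘ suc} {T = S ∘ suc} (λ j Sj → proj₁ (∖-elim S {zero} Sj)))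
card-remove S (suc i) Si rewrite ∧-identityʳ (S zero) = ℕ.+-monoʳ-< _ (card-remove (S ∘ suc) i Si)

-- Subsets are functions, so removal is not structurally smaller; the cardinality serves as fuel.
∖-induction : ∀ {k} (P : (Fin k → Bool) → Set) →
  (∀ S → (∀ i → S i ≡ true → P (S ∖ i)) → P S) → ∀ S → P S
∖-induction P step S = go (card S) S ℕ.≤-refl
  where
  go : ∀ fuel S → card S ℕ.≤ fuel → P S
  go zero S enough = step S λ i Si →
    ⊥-elim (ℕ.n≮0 (ℕ.<-≤-trans (card-remove S i Si) enough))
  go (suc fuel) S enough = step S λ i Si →
    go fuel (S ∖ i) (ℕ.≤-pred (ℕ.<-≤-trans (card-remove S i Si) enough))

-- Connectivity by edge sets

Joins : ∀ {n m} (src tgt : Fin m → Fin n) → Fin m → Fin n → Fin n → Set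
Joins src tgt e u v = (src e ≡ u × tgt e ≡ v) ⊎ (src e ≡ v × tgt e ≡ u)

-- Bare endpoint maps instead of a `Graph` let `labelling` recurse on the number of edges. For a
-- graph this unfolds to `Adj`, which looks only at `es`, so `Conn` and `Reach` agree
-- definitionally.
Link : ∀ {n m} (src tgt : Fin m → Fin n) → (Fin m → Bool) → Fin n → Fin n → Set
Link {m = m} src tgt F u v = Σ[ e ∈ Fin m ] (F e ≡ true × Joins src tgt e u v)

Conn : ∀ {n m} (src tgt : Fin m → Fin n) → (Fin m → Bool) → Fin n → Fin n → Set
Conn src tgt F = Star (Link src tgt F)

-- Acyclicity without cycles as data: every edge is a bridge. Component counts and tree exchanges
-- work with this form.
Bridged : ∀ {n m} (src tgt : Fin m → Fin n) → (Fin m → Bool) → Set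
Bridged src tgt F = ∀ e → F e ≡ true → ¬ Conn src tgt (F ∖ e) (src e) (tgt e)

-- Acyclicity as a count, which is also the integral shape of the subset constraints of FC-LP.
Sparse : ∀ {n m} (src tgt : Fin m → Fin n) → (Fin m → Bool) → Set
Sparse src tgt F = ∀ S s → S s ≡ true → 1ℚ + # (λ e → F e ∧ (S (src e) ∧ S (tgt e))) ≤ # S

conn-map : ∀ {n m k} {src tgt : Fin m → Fin n} {F : Fin m → Bool} (h : Fin k → Fin m)
  {F′ : Fin k → Bool} → (∀ e → F′ e ≡ true → F (h e) ≡ true) →
  ∀ {u v} → Conn (src ∘ h) (tgt ∘ h) F′ u v → Conn src tgt F u v
conn-map h F′⊆F = Star.map λ { (e , Fe , j) → h e , F′⊆F e Fe , j }

module _ {n m : ℕ} {src tgt : Fin m → Fin n} where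

  conn-mono : ∀ {F F′ : Fin m → Bool} → (∀ e → F e ≡ true → F′ e ≡ true) →
    ∀ {u v} → Conn src tgt F u v → Conn src tgt F′ u v
  conn-mono = conn-map (λ e → e)

  link-sym : ∀ {F u v} → Link src tgt F u v → Link src tgt F v u
  link-sym (e , Fe , inj₁ j) = e , Fe , inj₂ j
  link-sym (e , Fe , inj₂ j) = e , Fe , inj₁ j

  conn-sym : ∀ {F u v} → Conn src tgt F u v → Conn src tgt F v u
  conn-sym = Star.reverse link-sym

  conn-edge : ∀ {F} e → F e ≡ true → Conn src tgt F (src e) (tgt e)
  conn-edge e Fe = (e , Fe , inj₁ (refl , refl)) ◅ ε

  conn-invariant : ∀ {F} {A : Set} (f : Fin n → A) → (∀ e → F e ≡ true → f (src e) ≡ f (tgt e)) →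
    ∀ {u v} → Conn src tgt F u v → f u ≡ f v
  conn-invariant f const ε = refl
  conn-invariant f const ((e , Fe , inj₁ (refl , refl)) ◅ p) =
    trans (const e Fe) (conn-invariant f const p)
  conn-invariant f const ((e , Fe , inj₂ (refl , refl)) ◅ p) =
    trans (sym (const e Fe)) (conn-invariant f const p)

  -- Cut the walk before its first and after its last use of `f` and discard the middle. If both
  -- cuts fall at the same end of `f`, the two pieces already connect without it.
  conn-split : ∀ F f {u v} → Conn src tgt F u v →
    Conn src tgt (F ∖ f) u v
    ⊎ (Conn src tgt (F ∖ f) u (src f) × Conn src tgt (F ∖ f) (tgt f) v)
    ⊎ (Conn src tgt (F ∖ f) u (tgt f) × Conn src tgt (F ∖ f) (src f) v)
  conn-split F f ε = inj₁ ε
  conn-split F f ((e , Fe , j) ◅ p) with f ≟ e | conn-split F f p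
  ... | no f≢e | inj₁ q              = inj₁ ((e , ∖-intro F Fe f≢e , j) ◅ q)
  ... | no f≢e | inj₂ (inj₁ (q , r)) = inj₂ (inj₁ ((e , ∖-intro F Fe f≢e , j) ◅ q , r))
  ... | no f≢e | inj₂ (inj₂ (q , r)) = inj₂ (inj₂ ((e , ∖-intro F Fe f≢e , j) ◅ q , r))
  conn-split F f ((e , Fe , inj₁ (refl , refl)) ◅ p) | yes refl | inj₁ q              = inj₂ (inj₁ (ε , q))
  conn-split F f ((e , Fe , inj₁ (refl , refl)) ◅ p) | yes refl | inj₂ (inj₁ (q , r)) = inj₂ (inj₁ (ε , r))
  conn-split F f ((e , Fe , inj₁ (refl , refl)) ◅ p) | yes refl | inj₂ (inj₂ (q , r)) = inj₁ r
  conn-split F f ((e , Fe , inj₂ (refl , refl)) ◅ p) | yes refl | inj₁ q              = inj₂ (inj₂ (ε , q))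
  conn-split F f ((e , Fe , inj₂ (refl , refl)) ◅ p) | yes refl | inj₂ (inj₁ (q , r)) = inj₁ r
  conn-split F f ((e , Fe , inj₂ (refl , refl)) ◅ p) | yes refl | inj₂ (inj₂ (q , r)) = inj₂ (inj₂ (ε , r))

  conn-bypass : ∀ {F F′} → (∀ e → F e ≡ true → Conn src tgt F′ (src e) (tgt e)) →
    ∀ {u v} → Conn src tgt F u v → Conn src tgt F′ u v
  conn-bypass detour ε = ε
  conn-bypass detour ((e , Fe , inj₁ (refl , refl)) ◅ p) = detour e Fe ◅◅ conn-bypass detour p
  conn-bypass detour ((e , Fe , inj₂ (refl , refl)) ◅ p) =
    conn-sym (detour e Fe) ◅◅ conn-bypass detour p

-- Component labellings

-- A canonical representative per component: connectivity becomes decidable, and components are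
-- counted as the fixed points of `label`. The two bounds compare this count with vertices minus
-- edges.
record Labelling {n m} (src tgt : Fin m → Fin n) (F : Fin m → Bool) : Set where
  field
    label : Fin n → Fin n
    idem  : ∀ i → label (label i) ≡ label i
    edge  : ∀ e → F e ≡ true → label (src e) ≡ label (tgt e)
    sound : ∀ u v → label u ≡ label v → Conn src tgt F u v

  root : Fin n → Bool
  root i = does (label i ≟ i)

  field
    root-lower : sumℚ {n} (λ _ → 1ℚ) ≤ # root + # F
    root-upper : Bridged src tgt F → # root + # F ≤ sumℚ {n} (λ _ → 1ℚ)

  complete : ∀ {u v} → Conn src tgt F u v → label u ≡ label v
  complete = conn-invariant label edge

-- Union-find, one edge at a time. An edge inside a class is redundant, against `Bridged`; an edge
-- between two classes costs exactly one root.
labelling : ∀ {n m} (src tgt : Fin m → Fin n) (F : Fin m → Bool) → Labelling src tgt F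
labelling {n} {zero} src tgt F = record
  { label = λ i → i
  ; idem = λ _ → refl
  ; edge = λ ()
  ; sound = λ { u v refl → ε }
  ; root-lower = ℚ.≤-reflexive (sym all-roots)
  ; root-upper = λ _ → ℚ.≤-reflexive all-roots
  }
  where
  all-roots : # (λ (i : Fin n) → does (i ≟ i)) + 0ℚ ≡ sumℚ {n} (λ _ → 1ℚ)
  all-roots = trans (ℚ.+-identityʳ _) (Σ-cong {n} (λ i → cong ⟦_⟧ (dec-true (i ≟ i) refl)))
labelling {n} {suc m} src tgt F with labelling (src ∘ suc) (tgt ∘ suc) (F ∘ suc) | F zero in F0
... | L | false = record
  { label = label
  ; idem = idem
  ; edge = λ { zero F0′ → ⊥-elim (true≢false F0′ F0) ; (suc e) Fe → edge e Fe }
  ; sound = λ u v eq → conn-map suc (λ _ Fe → Fe) (sound u v eq)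
  ; root-lower = subst (λ q → sumℚ {n} (λ _ → 1ℚ) ≤ # root + q) (sym #F) root-lower
  ; root-upper = λ b → subst (λ q → # root + q ≤ sumℚ {n} (λ _ → 1ℚ)) (sym #F)
      (root-upper (λ e Fe c → b (suc e) Fe (conn-map suc (λ _ Fg → Fg) c)))
  }
  where
  open Labelling L
  #F : # F ≡ # (F ∘ suc)
  #F = trans (cong (λ b → ⟦ b ⟧ + # (F ∘ suc)) F0) (ℚ.+-identityˡ _)
... | L | true with Labelling.label L (src zero) ≟ Labelling.label L (tgt zero)
...   | yes same = record
  { label = label
  ; idem = idem
  ; edge = λ { zero _ → same ; (suc e) Fe → edge e Fe }
  ; sound = λ u v eq → conn-map suc (λ _ Fe → Fe) (sound u v eq)
  ; root-lower = ℚ.≤-trans root-lower (ℚ.+-monoʳ-≤ (# root)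
      (by-gap {# (F ∘ suc)} {# F} (⟦⟧≥0 (F zero)) (extra ⟦ F zero ⟧ (# (F ∘ suc)))))
  ; root-upper = λ b → ⊥-elim (b zero F0
      (conn-map suc (λ e Fe → ∖-intro F {zero} Fe (λ ())) (sound _ _ same)))
  }
  where
  open Labelling L
  extra : ∀ p q → (p + q) - q ≡ p
  extra p q = solve (p ∷ q ∷ []) ℚ-ring
...   | no distinct = record
  { label = merged
  ; idem = merged-idem
  ; edge = λ { zero _ → merged-first ; (suc e) Fe → cong merge (edge e Fe) }
  ; sound = merged-sound
  ; root-lower = subst (sumℚ {n} (λ _ → 1ℚ) ≤_) same-total root-lower
  ; root-upper = λ b → subst (_≤ sumℚ {n} (λ _ → 1ℚ)) same-total
      (root-upper (λ e Fe c → b (suc e) Fe (conn-map suc (λ _ Fg → Fg) c)))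
  }
  where
  open Labelling L
  a b : Fin n
  a = label (src zero)
  b = label (tgt zero)

  merge : Fin n → Fin n
  merge i = if does (i ≟ a) then b else i

  merged : Fin n → Fin n
  merged i = merge (label i)

  lift : ∀ {u v} → Conn (src ∘ suc) (tgt ∘ suc) (F ∘ suc) u v → Conn src tgt F u v
  lift = conn-map suc (λ _ Fe → Fe)

  merge-a : merge a ≡ b
  merge-a rewrite dec-true (a ≟ a) refl = refl

  merge-≢a : ∀ {i} → i ≢ a → merge i ≡ i
  merge-≢a {i} i≢a rewrite dec-false (i ≟ a) i≢a = refl

  merged-first : merge a ≡ merge b
  merged-first = trans merge-a (sym (merge-≢a (distinct ∘ sym)))

  merged-idem : ∀ i → merged (merged i) ≡ merged i
  merged-idem i with label i ≟ a
  ... | yes _  = trans (cong merge (idem (tgt zero))) (merge-≢a (distinct ∘ sym))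
  ... | no ≢a = trans (cong merge (idem i)) (merge-≢a ≢a)

  bridge : Conn src tgt F (src zero) (tgt zero)
  bridge = conn-edge zero F0

  merged-sound : ∀ u v → merged u ≡ merged v → Conn src tgt F u v
  merged-sound u v eq with label u ≟ a | label v ≟ a
  ... | yes p | yes q = lift (sound u v (trans p (sym q)))
  ... | yes p | no  _ = lift (sound u (src zero) p) ◅◅ bridge ◅◅ lift (sound (tgt zero) v eq)
  ... | no  _ | yes q = lift (sound u (tgt zero) eq) ◅◅ conn-sym bridge ◅◅ lift (sound (src zero) v (sym q))
  ... | no  _ | no  _ = lift (sound u v eq)

  -- Redirecting class `a` to `b` destroys the root `a` and no other: `b` keeps its label, and the
  -- other members of class `a` are fixed neither before nor after.
  lost-root : ∀ i → ⟦ does (merged i ≟ i) ⟧ + ⟦ does (a ≟ i) ⟧ ≡ ⟦ root i ⟧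
  lost-root i with a ≟ i
  ... | yes refl rewrite idem (src zero) | merge-a | dec-false (b ≟ a) (distinct ∘ sym) | dec-true
            (a ≟ a) refl = refl
  ... | no a≢i = trans (ℚ.+-identityʳ _) (cong ⟦_⟧ (kept (label i ≟ a)))
    where
    kept : Dec (label i ≡ a) → does (merged i ≟ i) ≡ does (label i ≟ i)
    kept (no ≢a) = cong (λ z → does (z ≟ i)) (merge-≢a ≢a)
    kept (yes eq) = trans (dec-false (merged i ≟ i) b≢i)
                          (sym (dec-false (label i ≟ i) (λ li → a≢i (trans (sym eq) li))))
      where
      b≢i : merged i ≢ i
      b≢i mi = distinct (trans (sym eq)
          (trans (cong label (trans (sym mi) (trans (cong merge eq) merge-a))) (idem (tgt zero))))

  same-total : # root + # (F ∘ suc) ≡ # (λ i → does (merged i ≟ i)) + # F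
  same-total = trans (cong (_+ # (F ∘ suc)) (sym #roots))
    (trans (ℚ.+-assoc (# (λ i → does (merged i ≟ i))) 1ℚ (# (F ∘ suc)))
           (cong (λ c → # (λ i → does (merged i ≟ i)) + (⟦ c ⟧ + # (F ∘ suc))) (sym F0)))
    where
    #roots : # (λ i → does (merged i ≟ i)) + 1ℚ ≡ # root
    #roots = trans (cong (# (λ i → does (merged i ≟ i)) +_) (sym (Σ-point a (λ _ → 1ℚ))))
      (trans (sym (Σ-+ (λ i → ⟦ does (merged i ≟ i) ⟧) (λ i → ⟦ does (a ≟ i) ⟧))) (Σ-cong lost-root))

-- Acyclicity by counting: sparsity, redundant edges and tree exchange.

module _ {n m : ℕ} {src tgt : Fin m → Fin n} where

  bridged-mono : ∀ {F F′ : Fin m → Bool} → (∀ e → F′ e ≡ true → F e ≡ true) →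
    Bridged src tgt F → Bridged src tgt F′
  bridged-mono {F} {F′} F′⊆F b e F′e c = b e (F′⊆F e F′e) (conn-mono widen c)
    where
    widen : ∀ g → (F′ ∖ e) g ≡ true → (F ∖ e) g ≡ true
    widen g g∈ = case ∖-elim F′ {e} g∈ of λ { (F′g , e≢g) → ∖-intro F (F′⊆F g F′g) e≢g }

  -- Count the components of the edges inside `S`: every vertex outside `S` is one by itself and the
  -- class of `s` is one more, while `root-upper` bounds components plus edges by the number of
  -- vertices.
  bridged⇒sparse : ∀ {F} → Bridged src tgt F → Sparse src tgt F
  bridged⇒sparse {F} b S s Ss = bound (# S) (# (not ∘ S)) (# root) (# F[S]) (sumℚ {n} (λ _ → 1ℚ))
      (#-complement S) (root-upper (bridged-mono (λ e Fe → proj₁ (∧-true Fe)) b)) many-roots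
    where
    F[S] : Fin m → Bool
    F[S] e = F e ∧ (S (src e) ∧ S (tgt e))

    open Labelling (labelling src tgt F[S])

    S-invariant : ∀ e → F[S] e ≡ true → S (src e) ≡ S (tgt e)
    S-invariant e eq with ∧-true {F e} eq
    ... | _ , both with ∧-true {S (src e)} both
    ...   | l , r = trans l (sym r)

    outside : ∀ {u v} → S u ≡ false → Conn src tgt F[S] u v → u ≡ v
    outside Su ε = refl
    outside Su ((e , Fe , j) ◅ _) with ∧-true {F e} Fe
    outside Su ((e , Fe , inj₁ (refl , _)) ◅ _) | _ , both = ⊥-elim (true≢false (proj₁ (∧-true both)) Su)
    outside Su ((e , Fe , inj₂ (_ , refl)) ◅ _) | _ , both = ⊥-elim
        (true≢false (proj₂ (∧-true {S (src e)} both)) Su)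

    is-root : ∀ i → ⟦ not (S i) ⟧ + ⟦ does (label s ≟ i) ⟧ ≤ ⟦ root i ⟧
    is-root i with S i in Si | label s ≟ i
    ... | true  | no _ = ⟦⟧≥0 _
    ... | true  | yes refl rewrite dec-true (label (label s) ≟ label s) (idem s) = ℚ.≤-refl
    ... | false | no _ rewrite dec-true (label i ≟ i)
              (sym (outside Si (sound i (label i) (sym (idem i))))) = ℚ.≤-refl
    ... | false | yes refl = ⊥-elim (true≢false
          (trans (sym (conn-invariant S S-invariant (sound s (label s) (sym (idem s))))) Ss) Si)

    many-roots : # (not ∘ S) + 1ℚ ≤ # root
    many-roots = ℚ.≤-trans (ℚ.≤-reflexive
      (trans (cong (# (not ∘ S) +_) (sym (Σ-point (label s) (λ _ → 1ℚ))))
             (sym (Σ-+ (λ i → ⟦ not (S i) ⟧) (λ i → ⟦ does (label s ≟ i) ⟧))))) (Σ-mono is-root)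

    bound : ∀ S′ C R E N → S′ + C ≡ N → R + E ≤ N → C + 1ℚ ≤ R → 1ℚ + E ≤ S′
    bound S′ C R E N refl p q = by-gap (gap p ⊕ gap q) (solve (S′ ∷ C ∷ R ∷ E ∷ []) ℚ-ring)

  -- Counting components shows that a connected replacement with no more edges
  -- has no redundant edge either.
  bridged-replace : ∀ {F F′} → Bridged src tgt F →
    (∀ {u v} → Conn src tgt F u v → Conn src tgt F′ u v) → # F′ ≤ # F → Bridged src tgt F′
  bridged-replace {F} {F′} b F≲F′ #F′≤#F g F′g c =
    1≰0 (absurd (# L.root) (# L′.root) (# F) (# (F′ ∖ g)) (sumℚ {n} (λ _ → 1ℚ))
      (L.root-upper b) L′.root-lower fewer
      (ℚ.≤-trans (ℚ.≤-reflexive (Σ-remove F′ (λ _ → 1ℚ) g F′g)) #F′≤#F))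
    where
    module L = Labelling (labelling src tgt F)
    module L′ = Labelling (labelling src tgt (F′ ∖ g))

    detour : ∀ e → F′ e ≡ true → Conn src tgt (F′ ∖ g) (src e) (tgt e)
    detour e F′e with g ≟ e
    ... | yes refl = c
    ... | no g≢e   = conn-edge e (∖-intro F′ F′e g≢e)

    fewer : # L′.root ≤ # L.root
    fewer = #-injection L.label (λ i _ → dec-true (L.label (L.label i) ≟ L.label i) (L.idem i))
      λ i j ri rj eq → trans (sym (holds (L′.label i ≟ i) ri))
        (trans (L′.complete (conn-bypass detour (F≲F′ (L.sound i j eq)))) (holds (L′.label j ≟ j) rj))

    absurd : ∀ r r′ f f′ N → r + f ≤ N → N ≤ r′ + f′ → r′ ≤ r → f′ + 1ℚ ≤ f → 1ℚ ≤ 0ℚ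
    absurd r r′ f f′ N p q s t = by-gap (gap p ⊕ gap q ⊕ gap s ⊕ gap t)
      (solve (r ∷ r′ ∷ f ∷ f′ ∷ N ∷ []) ℚ-ring)

  -- Delete edges outside `Q` for as long as `u` and `v` stay joined. `Q` alone does not join them,
  -- so the process must meet an edge whose deletion separates them. This stands in for choosing an
  -- edge outside `Q` on the tree path.
  critical-edge : ∀ (Q : Fin m → Bool) {u v} → ¬ Conn src tgt Q u v → ∀ X → Conn src tgt X u v →
    Σ[ X′ ∈ (Fin m → Bool) ] Σ[ f ∈ Fin m ] ((∀ e → X′ e ≡ true → X e ≡ true)
      × X′ f ≡ true × Q f ≡ false × Conn src tgt X′ u v × ¬ Conn src tgt (X′ ∖ f) u v)
  critical-edge Q {u} {v} ¬Q = ∖-induction _ step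
    where
    step : ∀ X → (∀ f → X f ≡ true → Conn src tgt (X ∖ f) u v → _) → Conn src tgt X u v → _
    step X ih c with any? (λ f → (X f ≟ᵇ true) ×-dec (Q f ≟ᵇ false))
    ... | no none = ⊥-elim (¬Q (conn-mono X⊆Q c))
      where
      X⊆Q : ∀ e → X e ≡ true → Q e ≡ true
      X⊆Q e Xe with Q e in Qe
      ... | true  = refl
      ... | false = ⊥-elim (none (e , Xe , Qe))
    ... | yes (f , Xf , Qf) with Labelling.label (labelling src tgt (X ∖ f)) u ≟ Labelling.label
              (labelling src tgt (X ∖ f)) v
    ...   | no cut  = X , f , (λ _ Xe → Xe) , Xf , Qf , c , λ c′ → cut
              (Labelling.complete (labelling src tgt (X ∖ f)) c′)
    ...   | yes still with ih f Xf (Labelling.sound (labelling src tgt (X ∖ f)) u v still)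
    ...     | X′ , f′ , X′⊆ , rest = X′ , f′ , (λ e X′e → proj₁ (∖-elim X {f} (X′⊆ e X′e))) , rest

  -- The edge `f` lies on the cycle that `e` closes, so its ends stay joined through `e` and nothing
  -- is disconnected. Since the edge count is unchanged, `bridged-replace` keeps every edge a
  -- bridge.
  exchange : ∀ {F Q} e → Bridged src tgt F → F e ≡ false → Conn src tgt F (src e) (tgt e) →
    ¬ Conn src tgt Q (src e) (tgt e) →
    Σ[ f ∈ Fin m ] (F f ≡ true × Q f ≡ false × Bridged src tgt (F ∖ f ∪ e)
      × (∀ {u v} → Conn src tgt F u v → Conn src tgt (F ∖ f ∪ e) u v))
  exchange {F} {Q} e b Fe c ¬Q with critical-edge Q ¬Q F c
  ... | X , f , X⊆F , Xf , Qf , joined , cut =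
        f , Ff , Qf , bridged-replace b spans (ℚ.≤-reflexive same-size) , spans
    where
    Ff = X⊆F f Xf
    T = F ∖ f ∪ e

    widen : ∀ g → (X ∖ f) g ≡ true → T g ≡ true
    widen g g∈ = case ∖-elim X {f} g∈ of λ { (Xg , f≢g) → ∨-introˡ (∖-intro F (X⊆F g Xg) f≢g) }

    e-joined : Conn src tgt T (src e) (tgt e)
    e-joined = conn-edge e (∪-new (F ∖ f) e)

    f-joined : Conn src tgt T (src f) (tgt f)
    f-joined with conn-split X f joined
    ... | inj₁ p = ⊥-elim (cut p)
    ... | inj₂ (inj₁ (p , q)) = conn-sym (conn-mono widen p) ◅◅ e-joined ◅◅ conn-sym (conn-mono widen q)
    ... | inj₂ (inj₂ (p , q)) = conn-mono widen q ◅◅ conn-sym e-joined ◅◅ conn-mono widen p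

    detour : ∀ g → F g ≡ true → Conn src tgt T (src g) (tgt g)
    detour g Fg with f ≟ g
    ... | yes refl = f-joined
    ... | no f≢g   = conn-edge g (∨-introˡ (∖-intro F Fg f≢g))

    spans : ∀ {u v} → Conn src tgt F u v → Conn src tgt T u v
    spans = conn-bypass detour

    e∉ : (F ∖ f) e ≡ false
    e∉ rewrite Fe = refl

    same-size : # T ≡ # F
    same-size = trans (Σ-add (F ∖ f) (λ _ → 1ℚ) e e∉) (Σ-remove F (λ _ → 1ℚ) f Ff)

-- Cycles versus bridges

Chain : ∀ {A : Set} → (A → A → Set) → A → List A → A → Set
Chain R u []       v = u ≡ v
Chain R u (z ∷ zs) v = R u z × Chain R z zs v

module _ {k : ℕ} {R : Fin k → Fin k → Set} where

  chain-suffix : ∀ {u z zs v} → u ∈ z ∷ zs → Chain R z zs v → Unique (z ∷ zs) →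
    ∃ λ ws → Chain R u ws v × Unique (u ∷ ws)
  chain-suffix {zs = zs} (here refl) ch uniq = zs , ch , uniq
  chain-suffix {zs = _ ∷ _} (there u∈) (_ , ch) (_ AllPairs.∷ uniq) = chain-suffix u∈ ch uniq

  simple-chain : ∀ {u v} → Star R u v → ∃ λ ws → Chain R u ws v × Unique (u ∷ ws)
  simple-chain ε = [] , refl , All.[] AllPairs.∷ AllPairs.[]
  simple-chain {u} (_◅_ {j = z} r p) with simple-chain p
  ... | ws , ch , uniq with _∈?_ _≟_ u (z ∷ ws)
  ...   | yes u∈ = chain-suffix u∈ ch uniq
  ...   | no u∉  = z ∷ ws , (r , ch) , ¬Any⇒All¬ _ u∉ AllPairs.∷ uniq

  close-chain : ∀ {u v t} ws → Chain R u ws v → R v t → Linked R (u ∷ ws ++ [ t ])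
  close-chain []       refl     r = r Linked.∷ [-]
  close-chain (w ∷ ws) (q , ch) r = q Linked.∷ close-chain ws ch r

module _ (G : Graph) where
  open Graph G

  -- A connection that avoids `e` thins out to a simple chain, which `e` closes to a cycle. Chains
  -- too short for `Cycle` would make `e` a loop or one of two parallel edges.
  acyclic⇒bridged : ∀ {K F} → ¬ Cycle G ⟨ K , F ⟩ → Bridged src tgt F
  acyclic⇒bridged {K} {F} acyclic e Fe c with simple-chain c
  ... | [] , eq , _ = loopless e eq
  ... | z ∷ [] , ((g , g∈ , j) , refl) , _ = proj₂ (∖-elim F {e} g∈) (simple e g (swap j))
    where
    swap : Joins src tgt g (src e) (tgt e) →
      (src e ≡ src g × tgt e ≡ tgt g) ⊎ (src e ≡ tgt g × tgt e ≡ src g)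
    swap (inj₁ (p , q)) = inj₁ (sym p , sym q)
    swap (inj₂ (p , q)) = inj₂ (sym q , sym p)
  ... | ws@(_ ∷ _ ∷ _) , ch , uniq = acyclic (src e , ws , s≤s (s≤s z≤n) , uniq ,
          close-chain ws (widen ws ch) (e , Fe , inj₂ (refl , refl)))
    where
    widen : ∀ {u v} zs → Chain (Link src tgt (F ∖ e)) u zs v → Chain (Adj G ⟨ K , F ⟩) u zs v
    widen []       eq                   = eq
    widen (_ ∷ zs) ((g , g∈ , j) , ch) = (g , proj₁ (∖-elim F {e} g∈) , j) , widen zs ch

  -- The rest of a cycle is a detour around its first edge `e`, which joins `v` and `w`: every later
  -- link has an end other than these two, so it is not `e`.
  bridged⇒acyclic : ∀ {K F} → Bridged src tgt F → ¬ Cycle G ⟨ K , F ⟩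
  bridged⇒acyclic b (v , [] , () , _)
  bridged⇒acyclic b (v , _ ∷ [] , s≤s () , _)
  bridged⇒acyclic {K} {F} b
    (v , w ∷ z ∷ zs , _ , (v≢w All.∷ v≢z All.∷ v≢zs) AllPairs.∷ (w≢z All.∷ w≢zs) AllPairs.∷ _ ,
     (e , Fe , j) Linked.∷ l₁ Linked.∷ l) =
      b e Fe (orient j (conn-sym (avoid-link (v≢z ∘ sym) (w≢z ∘ sym) l₁
                                  ◅ avoid z zs (v≢z ∘ sym) (w≢z ∘ sym) v≢zs w≢zs l)))
    where
    other-edge : ∀ {p q g} → p ≢ v → p ≢ w → Joins src tgt g p q → e ≢ g
    other-edge {p} {q} p≢v p≢w jg refl = ends j jg
      where
      ends : Joins src tgt e v w → Joins src tgt e p q → ⊥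
      ends (inj₁ (s , _)) (inj₁ (s′ , _)) = p≢v (trans (sym s′) s)
      ends (inj₁ (_ , t)) (inj₂ (_ , t′)) = p≢w (trans (sym t′) t)
      ends (inj₂ (s , _)) (inj₁ (s′ , _)) = p≢w (trans (sym s′) s)
      ends (inj₂ (_ , t)) (inj₂ (_ , t′)) = p≢v (trans (sym t′) t)

    avoid-link : ∀ {p q} → p ≢ v → p ≢ w → Link src tgt F q p → Link src tgt (F ∖ e) q p
    avoid-link p≢v p≢w (g , Fg , jg) = g , ∖-intro F Fg (other-edge p≢v p≢w (flip jg)) , jg
      where
      flip : ∀ {p q} → Joins src tgt g q p → Joins src tgt g p q
      flip (inj₁ x) = inj₂ x
      flip (inj₂ x) = inj₁ x

    avoid : ∀ p ps → p ≢ v → p ≢ w → All (v ≢_) ps → All (w ≢_) ps →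
      Linked (Adj G ⟨ K , F ⟩) (p ∷ ps ++ [ v ]) → Conn src tgt (F ∖ e) p v
    avoid p [] p≢v p≢w _ _ (r Linked.∷ _) = link-sym (avoid-link p≢v p≢w (link-sym r)) ◅ ε
    avoid p (q ∷ ps) p≢v p≢w (v≢q All.∷ v≢ps) (w≢q All.∷ w≢ps) (r Linked.∷ rs) =
      link-sym (avoid-link p≢v p≢w (link-sym r)) ◅ avoid q ps (v≢q ∘ sym) (w≢q ∘ sym) v≢ps w≢ps rs

    orient : Joins src tgt e v w → Conn src tgt (F ∖ e) v w → Conn src tgt (F ∖ e) (src e) (tgt e)
    orient (inj₁ (refl , refl)) c = c
    orient (inj₂ (refl , refl)) c = conn-sym c

-- Decomposition into superlevel sets.

argmin : ∀ {k} (P : Fin k → Bool) (c : Fin k → ℚ) → (∃ λ i → P i ≡ true) →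
  Σ[ i ∈ Fin k ] (P i ≡ true × (∀ j → P j ≡ true → c i ≤ c j))
argmin {suc k} P c some with any? (λ i → P (suc i) ≟ᵇ true) | P zero in P0
... | no none | false = ⊥-elim (neither some)
  where
  neither : ¬ ∃ λ i → P i ≡ true
  neither (zero  , p) = true≢false p P0
  neither (suc i , p) = none (i , p)
... | no none | true = zero , P0 , least
  where
  least : ∀ j → P j ≡ true → c zero ≤ c j
  least zero    _ = ℚ.≤-refl
  least (suc j) p = ⊥-elim (none (j , p))
... | yes tail | b with argmin (P ∘ suc) (c ∘ suc) tail
...   | i , Pi , least with ℚ.≤-total (c zero) (c (suc i)) | b
...     | inj₁ _   | false = suc i , Pi , λ { zero p → ⊥-elim (true≢false p P0) ; (suc j) p → least j p }
...     | inj₁ c₀≤ | true  = zero , P0 , λ { zero _ → ℚ.≤-refl ; (suc j) p → ℚ.≤-trans c₀≤ (least j p) }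
...     | inj₂ ≤c₀ | _     = suc i , Pi , λ { zero _ → ≤c₀ ; (suc j) p → least j p }

-- A nonnegative function bounded by B is a nonnegative combination, of total
-- weight at most B, of the indicators of its superlevel sets.
layer-cake : ∀ {k} (α : Fin k → ℚ) (K : ℚ) (c : Fin k → ℚ) (B : ℚ) → 0ℚ ≤ B →
  (∀ e → 0ℚ ≤ c e × c e ≤ B) →
  (∀ s → 0ℚ < s → 0ℚ ≤ K + sumℚ (λ e → if does (s ℚ.≤? c e) then α e else 0ℚ)) →
  0ℚ ≤ K * B + sumℚ (λ e → α e * c e)
layer-cake {k} α K c₀ B₀ 0≤B₀ bounds₀ levels₀ =
  ∖-induction P step (λ _ → true) c₀ B₀ (λ _ _ → refl) 0≤B₀ bounds₀ levels₀
  where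
  -- `X` is any set containing the support of `c`. Subtracting the least positive value of `c` on
  -- the support removes at least its minimiser `e₀` from it.
  P : (Fin k → Bool) → Set
  P X = ∀ c B → (∀ e → 0ℚ < c e → X e ≡ true) → 0ℚ ≤ B → (∀ e → 0ℚ ≤ c e × c e ≤ B) →
    (∀ s → 0ℚ < s → 0ℚ ≤ K + sumℚ (λ e → if does (s ℚ.≤? c e) then α e else 0ℚ)) →
    0ℚ ≤ K * B + sumℚ (λ e → α e * c e)

  step : ∀ X → (∀ e → X e ≡ true → P (X ∖ e)) → P X
  step X ih c B support 0≤B bounds levels with any? (λ e → does (0ℚ ℚ.<? c e) ≟ᵇ true)
  ... | no none = subst (λ q → 0ℚ ≤ K * B + q) (sym flat)
            (subst (0ℚ ≤_) (sym (ℚ.+-identityʳ (K * B))) (*-nonneg 0≤K 0≤B))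
    where
    c≤0 : ∀ e → c e ≤ 0ℚ
    c≤0 e = ℚ.≮⇒≥ (λ 0<c → none (e , dec-true (0ℚ ℚ.<? c e) 0<c))

    flat : sumℚ (λ e → α e * c e) ≡ 0ℚ
    flat = Σ-zero (λ e → trans (cong (α e *_) (ℚ.≤-antisym (c≤0 e) (proj₁ (bounds e)))) (ℚ.*-zeroʳ (α e)))

    -- Level 1 exceeds every value of `c` here, so its superlevel set is empty and the hypothesis
    -- speaks of `K` alone.
    0≤K : 0ℚ ≤ K
    0≤K = subst (0ℚ ≤_) (trans (cong (K +_) (Σ-zero empty)) (ℚ.+-identityʳ K)) (levels 1ℚ (ℚ.positive⁻¹ 1ℚ))
      where
      empty : ∀ e → (if does (1ℚ ℚ.≤? c e) then α e else 0ℚ) ≡ 0ℚ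
      empty e = if-false (dec-false (1ℚ ℚ.≤? c e) (λ 1≤c → 1≰0 (ℚ.≤-trans 1≤c (c≤0 e))))
  ... | yes some with argmin (λ e → does (0ℚ ℚ.<? c e)) c some
  ...   | e₀ , c₀>0 , least =
          subst (0ℚ ≤_) recombine (ih e₀ (support e₀ μ>0) c′ (B - μ) support′
              (gap (proj₂ (bounds e₀))) bounds′ levels′
            ⊕ *-nonneg (ℚ.<⇒≤ μ>0) (levels μ μ>0))
    where
    μ = c e₀
    μ>0 : 0ℚ < μ
    μ>0 = holds (0ℚ ℚ.<? c e₀) c₀>0

    μ≤ : ∀ {e} → 0ℚ < c e → μ ≤ c e
    μ≤ {e} 0<c = least e (dec-true (0ℚ ℚ.<? c e) 0<c)

    c′ : Fin k → ℚ
    c′ e = if does (0ℚ ℚ.<? c e) then c e - μ else 0ℚ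

    c′-pos : ∀ {e} → 0ℚ < c e → c′ e ≡ c e - μ
    c′-pos {e} 0<c = if-true (dec-true (0ℚ ℚ.<? c e) 0<c)

    c′-zero : ∀ {e} → ¬ 0ℚ < c e → c′ e ≡ 0ℚ
    c′-zero {e} c≯0 = if-false (dec-false (0ℚ ℚ.<? c e) c≯0)

    support′ : ∀ e → 0ℚ < c′ e → (X ∖ e₀) e ≡ true
    support′ e 0<c′ with 0ℚ ℚ.<? c e
    ... | no c≯0  = ⊥-elim (ℚ.<-irrefl (sym (c′-zero c≯0)) 0<c′)
    ... | yes 0<c = ∖-intro X {e₀} (support e 0<c)
            λ { refl → ℚ.<-irrefl (sym (trans (c′-pos 0<c) (ℚ.+-inverseʳ μ))) 0<c′ }

    bounds′ : ∀ e → 0ℚ ≤ c′ e × c′ e ≤ B - μ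
    bounds′ e with 0ℚ ℚ.<? c e
    ... | yes 0<c = subst (λ q → 0ℚ ≤ q × q ≤ B - μ) (sym (c′-pos 0<c))
            (gap (μ≤ 0<c) , ℚ.+-monoˡ-≤ (- μ) (proj₂ (bounds e)))
    ... | no c≯0 = subst (λ q → 0ℚ ≤ q × q ≤ B - μ) (sym (c′-zero c≯0))
            (ℚ.≤-refl , gap (proj₂ (bounds e₀)))

    -- The superlevel sets of `c′` are those of `c` shifted by `μ`, so the hypothesis on levels is
    -- inherited.
    same-level : ∀ s → 0ℚ < s → ∀ e → does (s + μ ℚ.≤? c e) ≡ does (s ℚ.≤? c′ e)
    same-level s 0<s e with 0ℚ ℚ.<? c e
    ... | yes 0<c = does-⇔ (mk⇔
            (λ h → subst (s ≤_) (sym (c′-pos 0<c)) (by-gap (gap h) (shift (c e) s μ)))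
            (λ h → by-gap (gap (subst (s ≤_) (c′-pos 0<c) h)) (sym (shift (c e) s μ)))) (s + μ ℚ.≤? c e)
                (s ℚ.≤? c′ e)
      where
      shift : ∀ a b d → (a - d) - b ≡ a - (b + d)
      shift a b d = solve (a ∷ b ∷ d ∷ []) ℚ-ring
    ... | no c≯0 = trans (dec-false (s + μ ℚ.≤? c e) (λ h → c≯0 (ℚ.<-≤-trans (ℚ.+-mono-< 0<s μ>0) h)))
                         (sym (dec-false (s ℚ.≤? c′ e)
                           (λ h → ℚ.<-irrefl refl (ℚ.<-≤-trans 0<s (subst (s ≤_) (c′-zero c≯0) h)))))

    levels′ : ∀ s → 0ℚ < s → 0ℚ ≤ K + sumℚ (λ e → if does (s ℚ.≤? c′ e) then α e else 0ℚ)
    levels′ s 0<s = subst (λ q → 0ℚ ≤ K + q)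
      (Σ-cong (λ e → cong (λ b → if b then α e else 0ℚ) (same-level s 0<s e)))
      (levels (s + μ) (ℚ.+-mono-< 0<s μ>0))

    top : Fin k → ℚ
    top e = if does (μ ℚ.≤? c e) then α e else 0ℚ

    slice : ∀ e → α e * c′ e + μ * top e ≡ α e * c e
    slice e with 0ℚ ℚ.<? c e
    ... | yes 0<c = trans (cong₂ (λ t t′ → α e * t + μ * t′) (c′-pos 0<c)
              (if-true (dec-true (μ ℚ.≤? c e) (μ≤ 0<c))))
                          (regroup (α e) (c e) μ)
      where
      regroup : ∀ a b d → a * (b - d) + d * a ≡ a * b
      regroup a b d = solve (a ∷ b ∷ d ∷ []) ℚ-ring
    ... | no c≯0 = trans
          (cong₂ (λ t t′ → α e * t + μ * t′) (c′-zero c≯0)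
            (if-false (dec-false (μ ℚ.≤? c e) (λ h → c≯0 (ℚ.<-≤-trans μ>0 h)))))
          (trans (vanish (α e) μ) (cong (α e *_) (ℚ.≤-antisym (proj₁ (bounds e)) (ℚ.≮⇒≥ c≯0))))
      where
      vanish : ∀ a d → a * 0ℚ + d * 0ℚ ≡ a * 0ℚ
      vanish a d = solve (a ∷ d ∷ []) ℚ-ring

    recombine : (K * (B - μ) + sumℚ (λ e → α e * c′ e)) + μ * (K + sumℚ top) ≡ K * B + sumℚ (λ e → α e * c e)
    recombine = trans (regroup K B μ (sumℚ (λ e → α e * c′ e)) (sumℚ top))
      (cong (K * B +_) (trans (cong (sumℚ (λ e → α e * c′ e) +_) (sym (Σ-* μ top)))
        (trans (sym (Σ-+ (λ e → α e * c′ e) (λ e → μ * top e))) (Σ-cong slice))))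
      where
      regroup : ∀ K B d s t → (K * (B - d) + s) + d * (K + t) ≡ K * B + (s + d * t)
      regroup K B d s t = solve (K ∷ B ∷ d ∷ s ∷ t ∷ []) ℚ-ring

-- Leaves of forests

module _ (G : Graph) where
  open Graph G

  incident-elim : ∀ e v → incident G e v ≡ true → src e ≡ v ⊎ tgt e ≡ v
  incident-elim e v inc with ∨-true {does (src e ≟ v)} inc
  ... | inj₁ s = inj₁ (holds (src e ≟ v) s)
  ... | inj₂ t = inj₂ (holds (tgt e ≟ v) t)

  incident-src : ∀ e → incident G e (src e) ≡ true
  incident-src e = ∨-introˡ (dec-true (src e ≟ src e) refl)

  incident-tgt : ∀ e → incident G e (tgt e) ≡ true
  incident-tgt e = ∨-introʳ {does (src e ≟ tgt e)} (dec-true (tgt e ≟ tgt e) refl)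

  star : (Fin m → Bool) → Fin n → Fin m → Bool
  star F v e = F e ∧ incident G e v

  TwoEdges : (Fin m → Bool) → Fin n → Set
  TwoEdges F v = Σ[ e ∈ Fin m ] Σ[ e′ ∈ Fin m ] (e ≢ e′ × star F v e ≡ true × star F v e′ ≡ true)

  Leaf : (Fin m → Bool) → Fin n → Fin m → Set
  Leaf F v f = star F v f ≡ true × ¬ (∃ λ e → star F v e ≡ true × e ≢ f)

  handshake : ∀ F → sumℚ (λ v → # (star F v)) ≤ # F + # F
  handshake F = ℚ.≤-trans (ℚ.≤-reflexive (Σ-comm (λ v e → ⟦ star F v e ⟧)))
    (ℚ.≤-trans (Σ-mono ends) (ℚ.≤-reflexive (Σ-+ (⟦_⟧ ∘ F) (⟦_⟧ ∘ F))))
    where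
    either : ∀ a b → ⟦ a ∨ b ⟧ ≤ ⟦ a ⟧ + ⟦ b ⟧
    either true  true  = by-gap 0≤1 refl
    either true  false = ℚ.≤-refl
    either false b     = ℚ.≤-reflexive (sym (ℚ.+-identityˡ ⟦ b ⟧))

    ends : ∀ e → sumℚ (λ v → ⟦ star F v e ⟧) ≤ ⟦ F e ⟧ + ⟦ F e ⟧
    ends e with F e
    ... | false = ℚ.≤-reflexive (Σ-zero {n} (λ _ → refl))
    ... | true  = ℚ.≤-trans (Σ-mono (λ v → either (does (src e ≟ v)) (does (tgt e ≟ v))))
            (ℚ.≤-reflexive (trans (Σ-+ (λ v → ⟦ does (src e ≟ v) ⟧) (λ v → ⟦ does (tgt e ≟ v) ⟧))
              (cong₂ _+_ (Σ-point (src e) (λ _ → 1ℚ)) (Σ-point (tgt e) (λ _ → 1ℚ)))))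

  two-edges⇒2≤degree : ∀ F v → TwoEdges F v → 1ℚ + 1ℚ ≤ # (star F v)
  two-edges⇒2≤degree F v (e , e′ , e≢e′ , e∈ , e′∈) = ℚ.≤-trans
    (ℚ.≤-reflexive (sym (trans (Σ-+ (λ g → ⟦ does (e ≟ g) ⟧) (λ g → ⟦ does (e′ ≟ g) ⟧))
      (cong₂ _+_ (Σ-point e (λ _ → 1ℚ)) (Σ-point e′ (λ _ → 1ℚ))))))
    (Σ-mono both)
    where
    both : ∀ g → ⟦ does (e ≟ g) ⟧ + ⟦ does (e′ ≟ g) ⟧ ≤ ⟦ star F v g ⟧
    both g with e ≟ g | e′ ≟ g
    ... | yes refl | yes refl = ⊥-elim (e≢e′ refl)
    ... | yes refl | no _     rewrite e∈  = ℚ.≤-refl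
    ... | no _     | yes refl rewrite e′∈ = ℚ.≤-refl
    ... | no _     | no _     = ⟦⟧≥0 _

  -- Otherwise all touched vertices have degree at least two, and by `handshake` they span at least
  -- as many edges as there are of them, against sparsity.
  leaf-exists : ∀ F → Sparse src tgt F → ∀ e → F e ≡ true → ∃ λ v → ∃ λ f → Leaf F v f
  leaf-exists F sparse e₀ Fe₀
    with any? (λ v → any? (λ f → (star F v f ≟ᵇ true) ×-dec ¬?
        (any? (λ e → (star F v e ≟ᵇ true) ×-dec ¬? (e ≟ f)))))
  ... | yes leaf = leaf
  ... | no none  = ⊥-elim (1≰0 (absurd (# F) (# touched)
            (ℚ.≤-trans (ℚ.+-monoʳ-≤ 1ℚ (Σ-mono spanned))
                (sparse touched (src e₀) (touch e₀ Fe₀ (src e₀) (incident-src e₀))))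
        (ℚ.≤-trans (ℚ.≤-reflexive (sym (Σ-+ (⟦_⟧ ∘ touched) (⟦_⟧ ∘ touched))))
            (ℚ.≤-trans (Σ-mono degree≥2) (handshake F)))))
    where
    touched : Fin n → Bool
    touched v = anyF (star F v)

    touch : ∀ e → F e ≡ true → ∀ v → incident G e v ≡ true → touched v ≡ true
    touch e Fe v inc = anyF-intro (star F v) e (∧-intro Fe inc)

    spanned : ∀ e → ⟦ F e ⟧ ≤ ⟦ F e ∧ (touched (src e) ∧ touched (tgt e)) ⟧
    spanned e = ⟦⟧-mono (λ Fe → ∧-intro Fe
        (∧-intro (touch e Fe (src e) (incident-src e)) (touch e Fe (tgt e) (incident-tgt e))))

    degree≥2 : ∀ v → ⟦ touched v ⟧ + ⟦ touched v ⟧ ≤ # (star F v)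
    degree≥2 v with touched v in tv
    ... | false = Σ-nonneg (λ e → ⟦⟧≥0 (star F v e))
    ... | true with anyF-true (star F v) tv
    ...   | f , f∈ with any? (λ e → (star F v e ≟ᵇ true) ×-dec ¬? (e ≟ f))
    ...     | no only = ⊥-elim (none (v , f , f∈ , only))
    ...     | yes (e , e∈ , e≢f) = two-edges⇒2≤degree F v (e , f , e≢f , e∈ , f∈)

    absurd : ∀ f t → 1ℚ + f ≤ t → t + t ≤ f + f → 1ℚ ≤ 0ℚ
    absurd f t p q = by-gap (gap p ⊕ gap p ⊕ gap q ⊕ 0≤1) (solve (f ∷ t ∷ []) ℚ-ring)

  -- Leaves are nonnegative, so one may repeatedly remove a leaf and credit its
  -- value, minus the cost of its edge, to its neighbour.
  peel : ∀ (I : Fin m → Bool) F (val : Fin n → ℚ) → Sparse src tgt F →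
    (∀ e → F e ≡ true → I e ≡ true → 1ℚ ≤ val (src e) × 1ℚ ≤ val (tgt e)) →
    (∀ e → F e ≡ true → 0ℚ ≤ val (src e) + val (tgt e)) →
    (∀ v → val v < 0ℚ → TwoEdges F v) →
    sumℚ (λ e → if F e then ⟦ I e ⟧ else 0ℚ) ≤ sumℚ val
  peel I = ∖-induction P step
    where
    P : (Fin m → Bool) → Set
    P F = (val : Fin n → ℚ) → Sparse src tgt F →
      (∀ e → F e ≡ true → I e ≡ true → 1ℚ ≤ val (src e) × 1ℚ ≤ val (tgt e)) →
      (∀ e → F e ≡ true → 0ℚ ≤ val (src e) + val (tgt e)) →
      (∀ v → val v < 0ℚ → TwoEdges F v) →
      sumℚ (λ e → if F e then ⟦ I e ⟧ else 0ℚ) ≤ sumℚ val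

    prune : ∀ F v u f → Joins src tgt f v u → Leaf F v f → P (F ∖ f) → P F
    prune F v u f j (f∈ , only) ih val sparse internal external neg =
      bound (sumℚ val′) (val v) (sumℚ val) cost _ (sumℚ (λ e → if F e then ⟦ I e ⟧ else 0ℚ))
        total (Σ-remove F (λ e → ⟦ I e ⟧) f Ff)
        (ih val′ sparse′ internal′ external′ neg′)
      where
      Ff = proj₁ (∧-true {F f} f∈)
      cost = ⟦ I f ⟧

      v≢u : v ≢ u
      v≢u v≡u = distinct j
        where
        distinct : ¬ Joins src tgt f v u
        distinct (inj₁ (s , t)) = loopless f (trans s (trans v≡u (sym t)))
        distinct (inj₂ (s , t)) = loopless f (trans s (trans (sym v≡u) (sym t)))

      f-ends : ∀ i → incident G f i ≡ true → i ≡ v ⊎ i ≡ u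
      f-ends i inc = ends j (incident-elim f i inc)
        where
        ends : Joins src tgt f v u → src f ≡ i ⊎ tgt f ≡ i → i ≡ v ⊎ i ≡ u
        ends (inj₁ (s , _)) (inj₁ refl) = inj₁ s
        ends (inj₂ (s , _)) (inj₁ refl) = inj₂ s
        ends (inj₁ (_ , t)) (inj₂ refl) = inj₂ t
        ends (inj₂ (_ , t)) (inj₂ refl) = inj₁ t

      v-avoids : ∀ e → (F ∖ f) e ≡ true → incident G e v ≡ true → ⊥
      v-avoids e e∈ inc = case ∖-elim F {f} e∈ of λ
        { (Fe , f≢e) → only (e , ∧-intro Fe inc , f≢e ∘ sym) }

      0≤v : 0ℚ ≤ val v
      0≤v = ℚ.≮⇒≥ (λ v<0 → two (neg v v<0))
        where
        two : ¬ TwoEdges F v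
        two (e , e′ , e≢e′ , e∈ , e′∈) with e ≟ f
        ... | no e≢f   = only (e , e∈ , e≢f)
        ... | yes refl = only (e′ , e′∈ , e≢e′ ∘ sym)

      orient : (R : ℚ → ℚ → Set) → (∀ {p q} → R p q → R q p) →
        R (val (src f)) (val (tgt f)) → R (val v) (val u)
      orient R R-sym = go j
        where
        go : Joins src tgt f v u → R (val (src f)) (val (tgt f)) → R (val v) (val u)
        go (inj₁ (refl , refl)) h = h
        go (inj₂ (refl , refl)) h = R-sym h

      f-external : 0ℚ ≤ val v + val u
      f-external = orient (λ p q → 0ℚ ≤ p + q) (λ {p} {q} → subst (0ℚ ≤_) (ℚ.+-comm p q)) (external f Ff)

      f-internal : I f ≡ true → 1ℚ ≤ val v × 1ℚ ≤ val u
      f-internal If = orient (λ p q → 1ℚ ≤ p × 1ℚ ≤ q) (λ (h , h′) → h′ , h) (internal f Ff If)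

      cost≤v : cost ≤ val v
      cost≤v with I f in If
      ... | true  = proj₁ (f-internal If)
      ... | false = 0≤v

      -- After the credit `u` is no longer negative, so it may lose the edge `f` without violating
      -- the two-edge condition.
      u-credited : 0ℚ ≤ val u + (val v - cost)
      u-credited with I f in If
      ... | true  = case f-internal If of λ { (1≤v , 1≤u) → ℚ.≤-trans 0≤1 1≤u ⊕ gap 1≤v }
      ... | false = subst (0ℚ ≤_) (reorder (val v) (val u)) f-external
        where
        reorder : ∀ a b → a + b ≡ b + (a - 0ℚ)
        reorder a b = solve (a ∷ b ∷ []) ℚ-ring

      val′ : Fin n → ℚ
      val′ i = if does (v ≟ i) then 0ℚ else (if does (u ≟ i) then val i + (val v - cost) else val i)

      -- Only `v` can lose value, and no remaining edge touches it; hence the conditions on edges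
      -- survive.
      grows : ∀ i → v ≢ i → val i ≤ val′ i
      grows i v≢i rewrite dec-false (v ≟ i) v≢i with u ≟ i
      ... | yes refl = by-gap (gap cost≤v) (cancel (val i) (val v - cost))
        where
        cancel : ∀ a b → (a + b) - a ≡ b
        cancel a b = solve (a ∷ b ∷ []) ℚ-ring
      ... | no _ = ℚ.≤-refl

      grows-src : ∀ e → (F ∖ f) e ≡ true → val (src e) ≤ val′ (src e)
      grows-src e e∈ = grows (src e) λ { refl → v-avoids e e∈ (incident-src e) }

      grows-tgt : ∀ e → (F ∖ f) e ≡ true → val (tgt e) ≤ val′ (tgt e)
      grows-tgt e e∈ = grows (tgt e) λ { refl → v-avoids e e∈ (incident-tgt e) }

      sparse′ : Sparse src tgt (F ∖ f)
      sparse′ S s Ss = ℚ.≤-trans (ℚ.+-monoʳ-≤ 1ℚ (Σ-mono smaller)) (sparse S s Ss)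
        where
        smaller : ∀ e → ⟦ (F ∖ f) e ∧ (S (src e) ∧ S (tgt e)) ⟧ ≤ ⟦ F e ∧ (S (src e) ∧ S (tgt e)) ⟧
        smaller e = ⟦⟧-mono (λ h → case ∧-true {(F ∖ f) e} h of λ
          { (e∈ , both) → ∧-intro (proj₁ (∖-elim F {f} e∈)) both })

      internal′ : ∀ e → (F ∖ f) e ≡ true → I e ≡ true → 1ℚ ≤ val′ (src e) × 1ℚ ≤ val′ (tgt e)
      internal′ e e∈ Ie = case internal e (proj₁ (∖-elim F {f} e∈)) Ie of λ
        { (h₁ , h₂) → ℚ.≤-trans h₁ (grows-src e e∈) , ℚ.≤-trans h₂ (grows-tgt e e∈) }

      external′ : ∀ e → (F ∖ f) e ≡ true → 0ℚ ≤ val′ (src e) + val′ (tgt e)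
      external′ e e∈ = ℚ.≤-trans (external e (proj₁ (∖-elim F {f} e∈)))
        (ℚ.+-mono-≤ (grows-src e e∈) (grows-tgt e e∈))

      neg′ : ∀ i → val′ i < 0ℚ → TwoEdges (F ∖ f) i
      neg′ i i<0 with v ≟ i | u ≟ i
      ... | yes refl | _        = ⊥-elim (ℚ.<-irrefl refl i<0)
      ... | no _     | yes refl = ⊥-elim (ℚ.<-irrefl refl (ℚ.≤-<-trans u-credited i<0))
      ... | no v≢i   | no u≢i   = case neg i i<0 of λ
            { (e , e′ , e≢e′ , e∈ , e′∈) → e , e′ , e≢e′ , keep e e∈ , keep e′ e′∈ }
        where
        keep : ∀ e → star F i e ≡ true → star (F ∖ f) i e ≡ true
        keep e e∈ with ∧-true {F e} e∈
        ... | Fe , inc = ∧-intro (∖-intro F {f} Fe λ { refl → not-end (f-ends i inc) }) inc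
          where
          not-end : ¬ (i ≡ v ⊎ i ≡ u)
          not-end (inj₁ i≡v) = v≢i (sym i≡v)
          not-end (inj₂ i≡u) = u≢i (sym i≡u)

      moved : ∀ i → val′ i + (if does (v ≟ i) then val i else 0ℚ)
                    ≡ val i + (if does (u ≟ i) then val v - cost else 0ℚ)
      moved i with v ≟ i | u ≟ i
      ... | yes refl | yes refl = ⊥-elim (v≢u refl)
      ... | yes refl | no _     = ℚ.+-comm 0ℚ (val i)
      ... | no _     | yes refl = ℚ.+-identityʳ _
      ... | no _     | no _     = refl

      total : sumℚ val′ + val v ≡ sumℚ val + (val v - cost)
      total = trans (cong (sumℚ val′ +_) (sym (Σ-point v val)))
        (trans (sym (Σ-+ val′ (λ i → if does (v ≟ i) then val i else 0ℚ)))
        (trans (Σ-cong moved)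
        (trans (Σ-+ val (λ i → if does (u ≟ i) then val v - cost else 0ℚ))
               (cong (sumℚ val +_) (Σ-point u (λ _ → val v - cost))))))

      bound : ∀ a′ q a c e′ e → a′ + q ≡ a + (q - c) → e′ + c ≡ e → e′ ≤ a′ → e ≤ a
      bound a′ q a c e′ e eq refl h = by-gap (gap h)
        (trans (split a q c e′)
          (trans (cong (λ z → z - q - e′) (sym eq)) (join a′ q e′)))
        where
        split : ∀ a q c e′ → a - (e′ + c) ≡ (a + (q - c)) - q - e′
        split a q c e′ = solve (a ∷ q ∷ c ∷ e′ ∷ []) ℚ-ring
        join : ∀ a′ q e′ → (a′ + q) - q - e′ ≡ a′ - e′
        join a′ q e′ = solve (a′ ∷ q ∷ e′ ∷ []) ℚ-ring

    step : ∀ F → (∀ f → F f ≡ true → P (F ∖ f)) → P F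
    step F ih val sparse internal external neg with any? (λ e → F e ≟ᵇ true)
    ... | no none = ℚ.≤-trans (ℚ.≤-reflexive (Σ-zero no-edge)) (Σ-nonneg nonneg)
      where
      no-edge : ∀ e → (if F e then ⟦ I e ⟧ else 0ℚ) ≡ 0ℚ
      no-edge e with F e in Fe
      ... | true  = ⊥-elim (none (e , Fe))
      ... | false = refl

      nonneg : ∀ v → 0ℚ ≤ val v
      nonneg v = ℚ.≮⇒≥ (λ v<0 → case neg v v<0 of λ { (e , _ , _ , e∈ , _) → none (e , proj₁ (∧-true e∈)) })
    ... | yes (e₀ , Fe₀) with leaf-exists F sparse e₀ Fe₀
    ...   | v , f , f∈ , only with incident-elim f v (proj₂ (∧-true {F f} f∈))
    ...     | inj₁ refl = prune F v (tgt f) f (inj₁ (refl , refl)) (f∈ , only) (ih f (proj₁ (∧-true f∈)))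
                            val sparse internal external neg
    ...     | inj₂ refl = prune F v (src f) f (inj₂ (refl , refl)) (f∈ , only) (ih f (proj₁ (∧-true f∈)))
                            val sparse internal external neg

-- Counts in ℕ and ℚ, component counts, and the LP lower bound.

card-unique : ∀ {k} (S : Fin k → Bool) i → S i ≡ true → (∀ j → S j ≡ true → j ≡ i) → card S ≡ 1
card-unique S zero Si only rewrite Si = cong suc (card-empty (S ∘ suc) rest)
  where
  card-empty : ∀ {k} (S : Fin k → Bool) → (∀ j → S j ≡ false) → card S ≡ 0
  card-empty {zero}  S none = refl
  card-empty {suc k} S none rewrite none zero = card-empty (S ∘ suc) (none ∘ suc)

  rest : ∀ j → S (suc j) ≡ false
  rest j = ≢true (λ Sj → case only (suc j) Sj of λ ())
card-unique S (suc i) Si only rewrite ≢true {S zero} (λ S0 → case only zero S0 of λ ()) =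
  card-unique (S ∘ suc) i Si (λ j Sj → suc-injective (only (suc j) Sj))

ℕtoℚ-card : ∀ {k} (S : Fin k → Bool) → ℕtoℚ (card S) ≡ # S
ℕtoℚ-card {zero}  S = refl
ℕtoℚ-card {suc k} S with S zero
... | true  = trans (ℕtoℚ-suc (card (S ∘ suc))) (cong (1ℚ +_) (ℕtoℚ-card (S ∘ suc)))
... | false = trans (ℕtoℚ-card (S ∘ suc)) (sym (ℚ.+-identityˡ (# (S ∘ suc))))

module _ (G : Graph) where
  open Graph G

  -- The labelling `f` is injective on the roots inside `F`, and the other roots number at most the
  -- vertices outside `F`; `root-lower` then gives the count.
  components-lower : ∀ F k → NumComponents G F k → # (vs F) ≤ ℕtoℚ k + # (es F)
  components-lower F k (f , same , _) =
    bound (# (vs F)) (# (not ∘ vs F)) (sumℚ {n} (λ _ → 1ℚ)) (# root) (# inner) (ℕtoℚ k) (# (es F))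
      (#-complement (vs F)) root-lower
      (ℚ.≤-trans (Σ-mono split) (ℚ.≤-reflexive (Σ-+ (⟦_⟧ ∘ inner) (λ i → ⟦ not (vs F i) ⟧))))
      (ℚ.≤-trans (#-injection {Q = λ _ → true} f (λ _ _ → refl) distinct) (ℚ.≤-reflexive (Σ-one k)))
    where
    open Labelling (labelling src tgt (es F))

    inner : Fin n → Bool
    inner i = vs F i ∧ root i

    split : ∀ i → ⟦ root i ⟧ ≤ ⟦ inner i ⟧ + ⟦ not (vs F i) ⟧
    split i with vs F i
    ... | true  = ℚ.≤-reflexive (sym (ℚ.+-identityʳ ⟦ root i ⟧))
    ... | false = ℚ.≤-trans (⟦⟧≤1 (root i)) (ℚ.≤-reflexive refl)

    distinct : ∀ i j → inner i ≡ true → inner j ≡ true → f i ≡ f j → i ≡ j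
    distinct i j pi pj eq with ∧-true {vs F i} pi | ∧-true {vs F j} pj
    ... | vi , ri | vj , rj = trans (sym (holds (label i ≟ i) ri))
          (trans (complete (proj₁ (same i j vi vj) eq)) (holds (label j ≟ j) rj))

    bound : ∀ V C N r i k E → V + C ≡ N → N ≤ r + E → r ≤ i + C → i ≤ k → V ≤ k + E
    bound V C N r i k E refl p q s = by-gap (gap p ⊕ gap q ⊕ gap s) (solve (V ∷ C ∷ r ∷ i ∷ k ∷ E ∷ []) ℚ-ring)

  -- Apply sparsity to each of the `k` parts cut out by `f`, which are nonempty since `f` is onto;
  -- each edge lies within the part of its source.
  components-upper : ∀ F k → WellFormed G F → Sparse src tgt (es F) → NumComponents G F k →
    ℕtoℚ k + # (es F) ≤ # (vs F)
  components-upper F k wf sparse (f , same , onto) = ℚ.≤-trans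
    (ℚ.+-mono-≤ (ℚ.≤-reflexive (sym (Σ-one k))) (ℚ.≤-trans (ℚ.≤-reflexive (Σ-fibre (f ∘ src) (⟦_⟧ ∘ es F)))
      (Σ-mono (λ c → Σ-mono (inside c)))))
    (ℚ.≤-trans (ℚ.≤-reflexive (sym (Σ-+ (λ _ → 1ℚ) (λ c → # (part-edges c)))))
    (ℚ.≤-trans (Σ-mono part-sparse)
      (ℚ.≤-reflexive (sym (trans (Σ-fibre f (⟦_⟧ ∘ vs F)) (Σ-cong (λ c → Σ-cong (in-part c))))))))
    where
    part : Fin k → Fin n → Bool
    part c i = vs F i ∧ does (f i ≟ c)

    part-edges : Fin k → Fin m → Bool
    part-edges c e = es F e ∧ (part c (src e) ∧ part c (tgt e))

    part-sparse : ∀ c → 1ℚ + # (part-edges c) ≤ # (part c)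
    part-sparse c with onto c
    ... | v , vv , fv = sparse (part c) v (∧-intro vv (dec-true (f v ≟ c) fv))

    in-part : ∀ c i → (if does (f i ≟ c) then ⟦ vs F i ⟧ else 0ℚ) ≡ ⟦ part c i ⟧
    in-part c i with does (f i ≟ c) | vs F i
    ... | true  | true  = refl
    ... | true  | false = refl
    ... | false | true  = refl
    ... | false | false = refl

    inside : ∀ c e → (if does (f (src e) ≟ c) then ⟦ es F e ⟧ else 0ℚ) ≤ ⟦ part-edges c e ⟧
    inside c e with f (src e) ≟ c
    ... | no _ = ⟦⟧≥0 (part-edges′ false)
      where
      part-edges′ : Bool → Bool
      part-edges′ b = es F e ∧ ((vs F (src e) ∧ b) ∧ part c (tgt e))
    ... | yes refl = ⟦⟧-mono all-in
      where
      all-in : es F e ≡ true → es F e ∧ ((vs F (src e) ∧ true) ∧ part c (tgt e)) ≡ true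
      all-in Ee with wf e Ee
      ... | vs-src , vs-tgt = ∧-intro Ee (∧-intro (∧-intro vs-src refl) (∧-intro vs-tgt
            (dec-true (f (tgt e) ≟ f (src e))
                (sym (proj₂ (same (src e) (tgt e) vs-src vs-tgt) (conn-edge e Ee))))))

  module _ (w : Fin m → ℚ) where

    discounted-sum : ∀ S → sumℚ (λ e → ⟦ S e ⟧ * (1ℚ - w e)) ≡ # S - edgeWeight G w S
    discounted-sum S = trans (Σ-cong pointwise) (Σ-- (⟦_⟧ ∘ S) (λ e → if S e then w e else 0ℚ))
      where
      pointwise : ∀ e → ⟦ S e ⟧ * (1ℚ - w e) ≡ ⟦ S e ⟧ - (if S e then w e else 0ℚ)
      pointwise e with S e
      ... | true  = ℚ.*-identityˡ (1ℚ - w e)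
      ... | false = ℚ.*-zeroˡ (1ℚ - w e)

    -- The subset constraint is sparsity of the forest on the vertices of `F` in `S`; there is one,
    -- because an edge induced by `S` has an end in the cover.
    forest-cover-feasible : ∀ F → IsForestCover G F → Feasible G w (⟦_⟧ ∘ vs F) (⟦_⟧ ∘ es F)
    forest-cover-feasible F ((wf , acyclic) , cover) =
        covered
      , (λ e → ⟦⟧-mono (proj₁ ∘ wf e) , ⟦⟧-mono (proj₂ ∘ wf e))
      , subset
      , (λ i → ⟦⟧≥0 (vs F i) , ⟦⟧≤1 (vs F i))
      , (λ e → ⟦⟧≥0 (es F e) , ⟦⟧≤1 (es F e))
      where
      covered : ∀ e → 1ℚ ≤ ⟦ vs F (src e) ⟧ + ⟦ vs F (tgt e) ⟧
      covered e = either (vs F (src e)) (vs F (tgt e)) (cover e)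
        where
        either : ∀ a b → a ≡ true ⊎ b ≡ true → 1ℚ ≤ ⟦ a ⟧ + ⟦ b ⟧
        either true  true  _ = by-gap 0≤1 refl
        either true  false _ = ℚ.≤-refl
        either false true  _ = ℚ.≤-refl
        either false false (inj₁ ())
        either false false (inj₂ ())

      subset : ∀ S → (Σ[ e ∈ Fin m ] inducedEdge G w S e ≡ true) →
        1ℚ ≤ sumℚ (λ i → if S i then ⟦ vs F i ⟧ else 0ℚ)
             - sumℚ (λ e → if inducedEdge G w S e then ⟦ es F e ⟧ else 0ℚ)
      subset S (e , Se) = bound (# S′) _ _ _ nonempty (ℚ.≤-reflexive (Σ-cong vertex)) (Σ-mono edge)
        where
        S′ : Fin n → Bool
        S′ i = S i ∧ vs F i

        nonempty : 1ℚ + # (λ e → es F e ∧ (S′ (src e) ∧ S′ (tgt e))) ≤ # S′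
        nonempty with ∧-true {S (src e)} Se | cover e
        ... | s , _ | inj₁ v = bridged⇒sparse (acyclic⇒bridged G {K = vs F} acyclic) S′ (src e) (∧-intro s v)
        ... | _ , t | inj₂ v = bridged⇒sparse (acyclic⇒bridged G {K = vs F} acyclic) S′ (tgt e) (∧-intro t v)

        vertex : ∀ i → ⟦ S′ i ⟧ ≡ (if S i then ⟦ vs F i ⟧ else 0ℚ)
        vertex i with S i
        ... | true  = refl
        ... | false = refl

        edge : ∀ e → (if inducedEdge G w S e then ⟦ es F e ⟧ else 0ℚ) ≤ ⟦ es F e ∧ (S′ (src e) ∧ S′ (tgt e)) ⟧
        edge e with S (src e) | S (tgt e)
        ... | true  | true  = ⟦⟧-mono (λ Ee → ∧-intro Ee (∧-intro (proj₁ (wf e Ee)) (proj₂ (wf e Ee))))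
        ... | true  | false = ⟦⟧≥0 (es F e ∧ (vs F (src e) ∧ false))
        ... | false | _     = ⟦⟧≥0 (es F e ∧ false)

        bound : ∀ s E V Y → 1ℚ + E ≤ s → s ≤ V → Y ≤ E → 1ℚ ≤ V - Y
        bound s E V Y p q r = by-gap (gap p ⊕ gap q ⊕ gap r) (solve (s ∷ E ∷ V ∷ Y ∷ []) ℚ-ring)

    optimal≤weighted-index : ∀ {x y} → Optimal G w x y → ∀ F a → IsForestCover G F →
      WeightedIndex G w F a → objective G w x y ≤ a
    optimal≤weighted-index {x} {y} (_ , least) F a cover (k , comps , refl) =
      ℚ.≤-trans (least (⟦_⟧ ∘ vs F) (⟦_⟧ ∘ es F) (forest-cover-feasible F cover))
        (bound (# (vs F)) (# (es F)) (edgeWeight G w (es F)) (ℕtoℚ k) _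
          (discounted-sum (es F)) (components-lower F k comps))
      where
      bound : ∀ V E W k D → D ≡ E - W → V ≤ k + E → V - D ≤ W + k
      bound V E W k D refl p = by-gap (gap p) (solve (V ∷ E ∷ W ∷ k ∷ []) ℚ-ring)

-- Spanning trees of `G*` and the pruned forest.

module Rounding (G : Graph) (w : Fin (Graph.m G) → ℚ) (x : Fin (Graph.n G) → ℚ) (y : Fin (Graph.m G) → ℚ)
  (feasible : Feasible G w x y) (M : Fin (Graph.m G) → Bool) (mst : MSTChoice G w x y M) where
  open Graph G

  V* : Fin n → Bool
  V* = Vstar G w x y
  E* : Fin m → Bool
  E* = Estar G w x y
  leaf? : Fin n → Bool
  leaf? = VD G w x y M
  T : Fin m → Bool
  T = es (APX G w x y M)
  V-APX : Fin n → Bool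
  V-APX = vs (APX G w x y M)

  edge-cover : ∀ e → 1ℚ ≤ x (src e) + x (tgt e)
  edge-cover = proj₁ feasible

  y≤x : ∀ e → y e ≤ x (src e) × y e ≤ x (tgt e)
  y≤x = proj₁ (proj₂ feasible)

  subset-bound : ∀ (S : Fin n → Bool) → (Σ[ e ∈ Fin m ] inducedEdge G w S e ≡ true) →
    1ℚ ≤ sumℚ (λ i → if S i then x i else 0ℚ) - sumℚ (λ e → if inducedEdge G w S e then y e else 0ℚ)
  subset-bound = proj₁ (proj₂ (proj₂ feasible))

  0≤x : ∀ i → 0ℚ ≤ x i
  0≤x i = proj₁ (proj₁ (proj₂ (proj₂ (proj₂ feasible))) i)

  x≤1 : ∀ i → x i ≤ 1ℚ
  x≤1 i = proj₂ (proj₁ (proj₂ (proj₂ (proj₂ feasible))) i)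

  0≤y : ∀ e → 0ℚ ≤ y e
  0≤y e = proj₁ (proj₂ (proj₂ (proj₂ (proj₂ feasible))) e)

  E*⇒V* : ∀ e → E* e ≡ true → V* (src e) ≡ true × V* (tgt e) ≡ true
  E*⇒V* e Ee = dec-true (0ℚ ℚ.<? x (src e)) (ℚ.<-≤-trans 0<y (proj₁ (y≤x e)))
             , dec-true (0ℚ ℚ.<? x (tgt e)) (ℚ.<-≤-trans 0<y (proj₂ (y≤x e)))
    where
    0<y : 0ℚ < y e
    0<y = holds (0ℚ ℚ.<? y e) Ee

  component : ∀ e → E* e ≡ true →
    Σ[ K ∈ (Fin n → Bool) ] (IsEdgeComponent G w x y K × K (src e) ≡ true × K (tgt e) ≡ true)
  component e Ee = K , (in-V* , joined , closed , e , Ee , src∈K)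
                     , src∈K , dec-true (label (src e) ≟ label (tgt e)) (edge e Ee)
    where
    open Labelling (labelling src tgt E*)

    K : Fin n → Bool
    K v = does (label (src e) ≟ label v)

    src∈K : K (src e) ≡ true
    src∈K = dec-true (label (src e) ≟ label (src e)) refl

    same : ∀ u → K u ≡ true → label (src e) ≡ label u
    same u = holds (label (src e) ≟ label u)

    in-V* : ∀ u → K u ≡ true → V* u ≡ true
    in-V* u Ku = trans
      (sym (conn-invariant V* (λ g Eg → trans (proj₁ (E*⇒V* g Eg)) (sym (proj₂ (E*⇒V* g Eg))))
          (sound (src e) u (same u Ku))))
      (proj₁ (E*⇒V* e Ee))

    joined : ∀ u v → K u ≡ true → K v ≡ true → Reach G (Gstar G w x y) u v
    joined u v Ku Kv = sound u v (trans (sym (same u Ku)) (same v Kv))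

    closed : ∀ u v → K u ≡ true → Reach G (Gstar G w x y) u v → K v ≡ true
    closed u v Ku p = dec-true (label (src e) ≟ label v) (trans (same u Ku) (complete p))

  M⊆E* : ∀ e → M e ≡ true → E* e ≡ true
  M⊆E* = proj₁ mst

  _↾_ : (Fin m → Bool) → (Fin n → Bool) → (Fin m → Bool)
  (X ↾ K) e = X e ∧ K (src e)

  restrict : ∀ K → IsEdgeComponent G w x y K → ∀ X → (∀ e → X e ≡ true → E* e ≡ true) →
    ∀ {u v} → K u ≡ true → Conn src tgt X u v → Conn src tgt (X ↾ K) u v
  restrict K isK X X⊆E* Ku ε = ε
  restrict K isK@(_ , _ , closed , _) X X⊆E* Ku ((g , Xg , inj₁ (refl , refl)) ◅ p) =
    (g , ∧-intro Xg Ku , inj₁ (refl , refl)) ◅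
      restrict K isK X X⊆E* (closed (src g) (tgt g) Ku (conn-edge g (X⊆E* g Xg))) p
  restrict K isK@(_ , _ , closed , _) X X⊆E* Ku ((g , Xg , inj₂ (refl , refl)) ◅ p) =
    (g , ∧-intro Xg Kv , inj₂ (refl , refl)) ◅ restrict K isK X X⊆E* Kv p
    where
    Kv = closed (tgt g) (src g) Ku (conn-sym (conn-edge g (X⊆E* g Xg)))

  bridged-M↾ : ∀ K → IsEdgeComponent G w x y K → Bridged src tgt (M ↾ K)
  bridged-M↾ K isK = acyclic⇒bridged G {K = K} (proj₁ (proj₂ (proj₁ (proj₂ mst K isK))))

  connected-M↾ : ∀ K → IsEdgeComponent G w x y K →
    ∀ u v → K u ≡ true → K v ≡ true → Conn src tgt (M ↾ K) u v
  connected-M↾ K isK = proj₂ (proj₂ (proj₁ (proj₂ mst K isK)))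

  -- `MSTChoice` gives acyclicity one component at a time, but a detour around `e` uses edges of
  -- `G*` and so never leaves the component of `e`.
  bridged-M : Bridged src tgt M
  bridged-M e Me c with component e (M⊆E* e Me)
  ... | K , isK , Ks , _ = bridged-M↾ K isK e (∧-intro Me Ks) (conn-mono shuffle
          (restrict K isK (M ∖ e) (λ g g∈ → M⊆E* g (proj₁ (∖-elim M {e} g∈))) Ks c))
    where
    shuffle : ∀ g → ((M ∖ e) ↾ K) g ≡ true → ((M ↾ K) ∖ e) g ≡ true
    shuffle g h with ∧-true {(M ∖ e) g} h
    ... | g∈ , Kg with ∖-elim M {e} g∈
    ...   | Mg , e≢g = ∖-intro (M ↾ K) (∧-intro Mg Kg) e≢g

  spanning-exchange : ∀ K → IsEdgeComponent G w x y K → ∀ e → E* e ≡ true →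
    K (src e) ≡ true → K (tgt e) ≡ true → ∀ f → Bridged src tgt ((M ↾ K) ∖ f ∪ e) →
    (∀ {u v} → Conn src tgt (M ↾ K) u v → Conn src tgt ((M ↾ K) ∖ f ∪ e) u v) →
    IsSpanningTree G w x y K ((M ↾ K) ∖ f ∪ e)
  spanning-exchange K isK e Ee Ks Kt f bridged spans =
    in-K , bridged⇒acyclic G {K = K} bridged , λ u v Ku Kv → spans (connected-M↾ K isK u v Ku Kv)
    where
    in-K : ∀ g → ((M ↾ K) ∖ f ∪ e) g ≡ true → E* g ≡ true × K (src g) ≡ true × K (tgt g) ≡ true
    in-K g g∈ with ∪-elim ((M ↾ K) ∖ f) {e} g∈
    ... | inj₂ refl = Ee , Ks , Kt
    ... | inj₁ g∈′ = proj₁ (proj₁ (proj₂ mst K isK)) g (proj₁ (∖-elim (M ↾ K) {f} g∈′))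

  lighter-edge : ∀ K → IsEdgeComponent G w x y K → ∀ e f → (M ↾ K) e ≡ false → (M ↾ K) f ≡ true →
    IsSpanningTree G w x y K ((M ↾ K) ∖ f ∪ e) → w f ≤ w e
  lighter-edge K isK e f e∉ f∈ spanning =
    compare (w f) (w e) (edgeWeight G w ((M ↾ K) ∖ f)) (edgeWeight G w (M ↾ K))
        (edgeWeight G w ((M ↾ K) ∖ f ∪ e))
      (Σ-remove (M ↾ K) w f f∈) (Σ-add ((M ↾ K) ∖ f) w e (cong (_∧ not (does (f ≟ e))) e∉))
      (proj₂ (proj₂ mst K isK) ((M ↾ K) ∖ f ∪ e) spanning)
    where
    compare : ∀ wf we r F T → r + wf ≡ F → T ≡ r + we → F ≤ T → wf ≤ we
    compare wf we r F T refl refl h = by-gap (gap h) (solve (wf ∷ we ∷ r ∷ []) ℚ-ring)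

  -- If `M` within `H` left the ends apart, `e` could be exchanged for a tree edge outside `H`. That
  -- edge is heavier than `e`, against minimality of the tree. An `e` already in `M` lies in `H`, as
  -- it is not heavier than itself.
  bottleneck : ∀ (H : Fin m → Bool) e → E* e ≡ true → (∀ f → H f ≡ false → w e < w f) →
    Conn src tgt (λ g → M g ∧ H g) (src e) (tgt e)
  bottleneck H e Ee heavy = decide (component e Ee) (label (src e) ≟ label (tgt e))
    where
    Q : Fin m → Bool
    Q g = M g ∧ H g

    open Labelling (labelling src tgt Q)

    in-M : M e ≡ true → Conn src tgt Q (src e) (tgt e)
    in-M Me = conn-edge e (∧-intro Me (light (H e) refl))
      where
      light : ∀ b → H e ≡ b → H e ≡ true
      light true  He = He
      light false He = ⊥-elim (ℚ.<-irrefl refl (heavy e He))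

    decide : Σ[ K ∈ (Fin n → Bool) ] (IsEdgeComponent G w x y K × K (src e) ≡ true × K (tgt e) ≡ true) →
      Dec (label (src e) ≡ label (tgt e)) → Conn src tgt Q (src e) (tgt e)
    decide _ (yes same) = sound (src e) (tgt e) same
    decide (K , isK , Ks , Kt) (no apart) = by-membership ((M ↾ K) e) refl
      where
      by-membership : ∀ b → (M ↾ K) e ≡ b → Conn src tgt Q (src e) (tgt e)
      by-membership true  e∈ = in-M (proj₁ (∧-true e∈))
      by-membership false e∉ = ⊥-elim (impossible
          (exchange {F = M ↾ K} {Q = Q} e (bridged-M↾ K isK) e∉ (connected-M↾ K isK (src e) (tgt e) Ks Kt)
              (λ c → apart (complete c))))
        where
        impossible : ¬ (Σ[ f ∈ Fin m ] ((M ↾ K) f ≡ true × Q f ≡ false × Bridged src tgt ((M ↾ K) ∖ f ∪ e)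
          × (∀ {u v} → Conn src tgt (M ↾ K) u v → Conn src tgt ((M ↾ K) ∖ f ∪ e) u v)))
        impossible (f , f∈ , Qf , bridged , spans) = ℚ.<-irrefl refl (ℚ.<-≤-trans (heavy f Hf)
          (lighter-edge K isK e f e∉ f∈ (spanning-exchange K isK e Ee Ks Kt f bridged spans)))
          where
          Hf : H f ≡ false
          Hf = ≢true (λ h → true≢false (∧-intro (proj₁ (∧-true {M f} f∈)) h) Qf)

  first-edge : ∀ {F u v} → Conn src tgt F u v → u ≢ v → ∃ λ e → star G F u e ≡ true
  first-edge ε u≢v = ⊥-elim (u≢v refl)
  first-edge ((g , Fg , inj₁ (refl , _)) ◅ _) _ = g , ∧-intro Fg (incident-src G g)
  first-edge ((g , Fg , inj₂ (_ , refl)) ◅ _) _ = g , ∧-intro Fg (incident-tgt G g)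

  M-edge-at : ∀ v → hasEdgeStar G w x y v ≡ true → ∃ λ e → star G M v e ≡ true
  M-edge-at v has with anyF-true (λ e → E* e ∧ incident G e v) has
  ... | e , h with ∧-true {E* e} h
  ...   | Ee , inc with component e Ee | incident-elim G e v inc
  ...     | K , isK , Ks , Kt | inj₁ refl =
              first-edge (conn-mono (λ g g∈ → proj₁ (∧-true g∈)) (connected-M↾ K isK (src e) (tgt e) Ks Kt))
                  (loopless e)
  ...     | K , isK , Ks , Kt | inj₂ refl =
              first-edge (conn-mono (λ g g∈ → proj₁ (∧-true g∈)) (connected-M↾ K isK (tgt e) (src e) Kt Ks))
                  (loopless e ∘ sym)

  APX-vertex : ∀ v → V-APX v ≡ true → ½ ≤ x v ⊎ (hasEdgeStar G w x y v ≡ true × leaf? v ≡ false)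
  APX-vertex v h with ∨-true {V* v ∧ hasEdgeStar G w x y v ∧ not (leaf? v)} h
  ... | inj₂ c = inj₁ (holds (½ ℚ.≤? x v) (proj₂ (∧-true {Chat G w x y v} c)))
  ... | inj₁ c with ∧-true {hasEdgeStar G w x y v} (proj₂ (∧-true {V* v} c))
  ...   | has , nl = inj₂ (has , not-true nl)

  leaf-light : ∀ v → leaf? v ≡ true → card (star G M v) ≡ 1 × x v < ½
  leaf-light v h with ∧-true {does (card (star G M v) ℕ.≟ 1)} h
  ... | d , l = holds (card (star G M v) ℕ.≟ 1) d , holds (x v ℚ.<? ½) l

  APX-not-leaf : ∀ v → V-APX v ≡ true → leaf? v ≡ false
  APX-not-leaf v h with APX-vertex v h
  ... | inj₁ heavy    = ≢true (λ l → ℚ.<-irrefl refl (ℚ.<-≤-trans (proj₂ (leaf-light v l)) heavy))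
  ... | inj₂ (_ , nl) = nl

  -- A light vertex isolated in `G*` does not enter `ChatA`, and one of degree one in `M` is pruned.
  light-APX⇒two-edges : ∀ v → V-APX v ≡ true → x v < ½ → TwoEdges G M v
  light-APX⇒two-edges v h light with APX-vertex v h
  ... | inj₁ heavy = ⊥-elim (ℚ.<-irrefl refl (ℚ.<-≤-trans light heavy))
  ... | inj₂ (has , nl) with M-edge-at v has
  ...   | f , f∈ with any? (λ e → (star G M v e ≟ᵇ true) ×-dec ¬? (e ≟ f))
  ...     | yes (e , e∈ , e≢f) = e , f , e≢f , e∈ , f∈
  ...     | no only = ⊥-elim (true≢false is-leaf nl)
    where
    unique : ∀ e → star G M v e ≡ true → e ≡ f
    unique e e∈ with e ≟ f
    ... | yes e≡f = e≡f
    ... | no e≢f  = ⊥-elim (only (e , e∈ , e≢f))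

    is-leaf : leaf? v ≡ true
    is-leaf = ∧-intro (dec-true (card (star G M v) ℕ.≟ 1) (card-unique (star G M v) f f∈ unique))
                      (dec-true (x v ℚ.<? ½) light)

  APX-well-formed : WellFormed G (APX G w x y M)
  APX-well-formed e Te with ∧-true {M e} Te
  ... | Me , ¬ED = kept (src e) (proj₁ (E*⇒V* e Ee)) (incident-src G e) (λ l → ends (∨-introˡ l))
                 , kept (tgt e) (proj₂ (E*⇒V* e Ee)) (incident-tgt G e)
                     (λ l → ends (∨-introʳ {leaf? (src e)} l))
    where
    Ee = M⊆E* e Me

    ends : leaf? (src e) ∨ leaf? (tgt e) ≡ true → ⊥
    ends l = true≢false (∧-intro Me l) (not-true ¬ED)

    kept : ∀ v → V* v ≡ true → incident G e v ≡ true → (leaf? v ≡ true → ⊥) → V-APX v ≡ true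
    kept v Vv inc ¬l = ∨-introˡ (∧-intro Vv (∧-intro
      (anyF-intro (λ g → E* g ∧ incident G g v) e (∧-intro Ee inc)) (cong not (≢true ¬l))))

-- The inequality at a single level.

module LevelSet (G : Graph) (w : Fin (Graph.m G) → ℚ) (x : Fin (Graph.n G) → ℚ) (y : Fin (Graph.m G) → ℚ)
  (feasible : Feasible G w x y) (M : Fin (Graph.m G) → Bool) (mst : MSTChoice G w x y M)
  (H : Fin (Graph.m G) → Bool) (lower : ∀ e f → H e ≡ true → H f ≡ false → w e < w f) where
  open Graph G
  open Rounding G w x y feasible M mst

  MH : Fin m → Bool
  MH e = M e ∧ H e

  touched : Fin n → Bool
  touched v = anyF (star G MH v)

  touch : ∀ e v → MH e ≡ true → incident G e v ≡ true → touched v ≡ true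
  touch e v e∈ inc = anyF-intro (star G MH v) e (∧-intro e∈ inc)

  -- With `# MH` subtracted, `ρ` sums to a lower bound for the LP at this level and `σ` to an upper
  -- bound for `APX`; a component of `MH` with an edge contributes 1 to either. `val` is the surplus
  -- of twice the former rate over the latter.
  ρ σ val : Fin n → ℚ
  ρ v = if touched v then 1ℚ else x v
  σ v = if touched v then 1ℚ else ⟦ V-APX v ⟧
  val v = (ρ v + ρ v) - σ v

  ρ≤1 : ∀ v → ρ v ≤ 1ℚ
  ρ≤1 v with touched v
  ... | true  = ℚ.≤-refl
  ... | false = x≤1 v

  level-edges : sumℚ (λ e → if M e then ⟦ H e ⟧ else 0ℚ) ≡ # MH
  level-edges = Σ-cong pointwise
    where
    pointwise : ∀ e → (if M e then ⟦ H e ⟧ else 0ℚ) ≡ ⟦ MH e ⟧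
    pointwise e with M e
    ... | true  = refl
    ... | false = refl

  -- The subset constraints, summed over the components of M ∩ H.
  components-bound : sumℚ ρ - # MH ≤ sumℚ x - sumℚ (λ e → if H e then y e else 0ℚ)
  components-bound = bound (sumℚ ρ) (# MH) (sumℚ {n} (λ _ → 1ℚ)) (# root) (sumℚ X - sumℚ Y) (sumℚ x) (sumℚ X)
      (sumℚ (λ e → if H e then y e else 0ℚ)) (sumℚ Y)
      root-lower
      (ℚ.≤-trans (ℚ.≤-reflexive (sym
          (trans (Σ-+ (λ r → ⟦ root r ⟧ - 1ℚ) ρ) (cong (_+ sumℚ ρ) (Σ-- (⟦_⟧ ∘ root) (λ _ → 1ℚ))))))
        (ℚ.≤-trans (Σ-mono per-class) (ℚ.≤-reflexive (Σ-- X Y))))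
      (Σ-fibre label x) edges-in-classes refl
    where
    open Labelling (labelling src tgt MH)

    class : Fin n → Fin n → Bool
    class r i = does (label i ≟ r)

    X Y : Fin n → ℚ
    X r = sumℚ (λ i → if class r i then x i else 0ℚ)
    Y r = sumℚ (λ e → if inducedEdge G w (class r) e then y e else 0ℚ)

    edges-in-classes : sumℚ (λ e → if H e then y e else 0ℚ) ≤ sumℚ Y
    edges-in-classes = ℚ.≤-trans (Σ-mono inside)
      (ℚ.≤-reflexive (Σ-comm (λ e r → if inducedEdge G w (class r) e then y e else 0ℚ)))
      where
      induced : ∀ e r → 0ℚ ≤ (if inducedEdge G w (class r) e then y e else 0ℚ)
      induced e r = when-nonneg (inducedEdge G w (class r) e) (0≤y e)

      own-class : ∀ e → label (src e) ≡ label (tgt e) →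
        y e ≤ sumℚ (λ r → if inducedEdge G w (class r) e then y e else 0ℚ)
      own-class e same = ℚ.≤-trans (ℚ.≤-reflexive (sym (if-true (∧-intro
          (dec-true (label (src e) ≟ label (src e)) refl)
              (dec-true (label (tgt e) ≟ label (src e)) (sym same))))))
        (Σ-term (induced e) (label (src e)))

      inside : ∀ e → (if H e then y e else 0ℚ) ≤ sumℚ (λ r → if inducedEdge G w (class r) e then y e else 0ℚ)
      inside e = by-level (H e) refl
        where
        by-level : ∀ b → H e ≡ b → (if b then y e else 0ℚ) ≤ sumℚ
            (λ r → if inducedEdge G w (class r) e then y e else 0ℚ)
        by-level false _  = Σ-nonneg (induced e)
        by-level true  He = by-support (0ℚ ℚ.<? y e)
          where
          -- Only edges with positive `y` belong to `G*`, where `bottleneck` applies; the others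
          -- contribute nothing.
          by-support : Dec (0ℚ < y e) → y e ≤ sumℚ (λ r → if inducedEdge G w (class r) e then y e else 0ℚ)
          by-support (no y≯0)  = ℚ.≤-trans (ℚ.≮⇒≥ y≯0) (Σ-nonneg (induced e))
          by-support (yes 0<y) = own-class e
              (complete (bottleneck H e (dec-true (0ℚ ℚ.<? y e) 0<y) (λ f Hf → lower e f He Hf)))

    -- Here `r` runs over all vertices. A non-root has an empty class and a nonpositive left side,
    -- so the sum contains the number of roots minus `n`, which is at least `- # MH` by
    -- `root-lower`.
    per-class : ∀ r → (⟦ root r ⟧ - 1ℚ) + ρ r ≤ X r - Y r
    per-class r = by-edge (any? (λ e → inducedEdge G w (class r) e ≟ᵇ true))
      where
      0≤term : ∀ i → 0ℚ ≤ (if class r i then x i else 0ℚ)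
      0≤term i = when-nonneg (class r i) (0≤x i)

      by-edge : Dec (∃ λ e → inducedEdge G w (class r) e ≡ true) → (⟦ root r ⟧ - 1ℚ) + ρ r ≤ X r - Y r
      by-edge (yes some) = ℚ.≤-trans (at-most (⟦ root r ⟧) (ρ r) (⟦⟧≤1 (root r)) (ρ≤1 r))
          (subset-bound (class r) some)
        where
        at-most : ∀ p q → p ≤ 1ℚ → q ≤ 1ℚ → (p - 1ℚ) + q ≤ 1ℚ
        at-most p q h₁ h₂ = by-gap (gap h₁ ⊕ gap h₂) (solve (p ∷ q ∷ []) ℚ-ring)
      by-edge (no none) = ℚ.≤-trans (by-root (label r ≟ r))
          (ℚ.≤-reflexive (sym (trans (cong (λ q → X r - q) Y≡0) (drop (X r)))))
        where
        drop : ∀ p → p - 0ℚ ≡ p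
        drop p = solve (p ∷ []) ℚ-ring

        Y≡0 : Y r ≡ 0ℚ
        Y≡0 = Σ-zero (λ e → if-false (≢true (λ h → none (e , h))))

        untouched : label r ≡ r → touched r ≡ false
        untouched lr = ≢true absurd
          where
          absurd : touched r ≡ true → ⊥
          absurd t with anyF-true (star G MH r) t
          ... | e , e∈ with ∧-true {MH e} e∈
          ...   | MHe , inc with incident-elim G e r inc
          ...     | inj₁ s = none (e , ∧-intro (dec-true (label (src e) ≟ r) (trans (cong label s) lr))
                      (dec-true (label (tgt e) ≟ r) (trans (sym (edge e MHe)) (trans (cong label s) lr))))
          ...     | inj₂ t′ = none (e , ∧-intro
                    (dec-true (label (src e) ≟ r) (trans (edge e MHe) (trans (cong label t′) lr)))
                      (dec-true (label (tgt e) ≟ r) (trans (cong label t′) lr)))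

        by-root : Dec (label r ≡ r) → (⟦ root r ⟧ - 1ℚ) + ρ r ≤ X r
        by-root (yes lr) = ℚ.≤-trans
          (ℚ.≤-reflexive (trans (cong₂ (λ p q → (p - 1ℚ) + q) (cong ⟦_⟧ (dec-true (label r ≟ r) lr))
              (if-false (untouched lr)))
            (ℚ.+-identityˡ (x r))))
          (ℚ.≤-trans (ℚ.≤-reflexive (sym (if-true (dec-true (label r ≟ r) lr)))) (Σ-term 0≤term r))
        by-root (no ¬lr) = ℚ.≤-trans
          (ℚ.≤-reflexive (cong (λ p → (p - 1ℚ) + ρ r) (cong ⟦_⟧ (dec-false (label r ≟ r) ¬lr))))
          (ℚ.≤-trans (nonpos (ρ r) (ρ≤1 r)) (Σ-nonneg 0≤term))
          where
          nonpos : ∀ q → q ≤ 1ℚ → (0ℚ - 1ℚ) + q ≤ 0ℚ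
          nonpos q h = by-gap (gap h) (solve (q ∷ []) ℚ-ring)

    bound : ∀ R E N r D x′ X′ h Y′ → N ≤ r + E → (r - N) + R ≤ D → x′ ≡ X′ → h ≤ Y′ → D ≡ X′ - Y′ → R - E
        ≤ x′ - h
    bound R E N r D x′ X′ h Y′ p q refl s refl = by-gap (gap p ⊕ gap q ⊕ gap s)
        (solve (R ∷ E ∷ N ∷ r ∷ X′ ∷ h ∷ Y′ ∷ []) ℚ-ring)

  -- The worst case is an untouched vertex of `APX`. The covering constraint turns this bound into
  -- the condition of `peel` on the two ends of an edge.
  2x-1≤val : ∀ v → (x v + x v) - 1ℚ ≤ val v
  2x-1≤val v with touched v
  ... | true  = by-gap (gap (x≤1 v) ⊕ gap (x≤1 v)) (cancel (x v))
    where
    cancel : ∀ q → ((1ℚ + 1ℚ) - 1ℚ) - ((q + q) - 1ℚ) ≡ (1ℚ - q) + (1ℚ - q)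
    cancel q = solve (q ∷ []) ℚ-ring
  ... | false = by-gap (gap (⟦⟧≤1 (V-APX v))) (cancel (x v) ⟦ V-APX v ⟧)
    where
    cancel : ∀ q b → ((q + q) - b) - ((q + q) - 1ℚ) ≡ 1ℚ - b
    cancel q b = solve (q ∷ b ∷ []) ℚ-ring

  touched-val : ∀ v → touched v ≡ true → 1ℚ ≤ val v
  touched-val v t = ℚ.≤-reflexive (sym (trans (cong₂ (λ p q → (p + p) - q) (if-true t) (if-true t)) refl))

  negative-val : ∀ v → val v < 0ℚ → V-APX v ≡ true × x v < ½
  negative-val v neg = in-APX (V-APX v) refl , ℚ.≰⇒> (λ ½≤x → ℚ.<-irrefl refl
      (ℚ.<-≤-trans neg (ℚ.≤-trans (by-gap (gap ½≤x ⊕ gap ½≤x) (double (x v))) (2x-1≤val v))))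
    where
    double : ∀ q → ((q + q) - 1ℚ) - 0ℚ ≡ (q - ½) + (q - ½)
    double q = solve (q ∷ []) ℚ-ring

    untouched : touched v ≡ false
    untouched = ≢true (λ t → ℚ.<-irrefl refl (ℚ.<-≤-trans neg (ℚ.≤-trans 0≤1 (touched-val v t))))

    in-APX : ∀ b → V-APX v ≡ b → V-APX v ≡ true
    in-APX true  h = h
    in-APX false h = ⊥-elim (ℚ.<-irrefl refl (ℚ.<-≤-trans neg (subst (0ℚ ≤_) (sym value) (0≤x v ⊕ 0≤x v))))
      where
      value : val v ≡ x v + x v
      value = trans (cong₂ (λ p q → (p + p) - q) (if-false untouched) (trans (if-false untouched) (cong ⟦_⟧ h)))
                    (ℚ.+-identityʳ (x v + x v))

  -- Peeling runs over all of `M`, with `H` marking the edges that cost 1: a negative vertex is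
  -- untouched, so it is paid for along edges of `M` outside the level.
  peel-M : # MH ≤ (sumℚ ρ + sumℚ ρ) - sumℚ σ
  peel-M = subst (_≤ (sumℚ ρ + sumℚ ρ) - sumℚ σ) level-edges (ℚ.≤-trans
    (peel G H M val (bridged⇒sparse bridged-M) internal external
      (λ v neg → case negative-val v neg of λ { (inA , light) → light-APX⇒two-edges v inA light }))
    (ℚ.≤-reflexive (trans (Σ-- (λ v → ρ v + ρ v) σ) (cong (_- sumℚ σ) (Σ-+ ρ ρ)))))
    where
    internal : ∀ e → M e ≡ true → H e ≡ true → 1ℚ ≤ val (src e) × 1ℚ ≤ val (tgt e)
    internal e Me He = touched-val (src e) (touch e (src e) (∧-intro Me He) (incident-src G e))
                     , touched-val (tgt e) (touch e (tgt e) (∧-intro Me He) (incident-tgt G e))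

    external : ∀ e → M e ≡ true → 0ℚ ≤ val (src e) + val (tgt e)
    external e _ = combine (x (src e)) (x (tgt e)) (val (src e)) (val (tgt e)) (edge-cover e)
        (2x-1≤val (src e)) (2x-1≤val (tgt e))
      where
      combine : ∀ a b p q → 1ℚ ≤ a + b → (a + a) - 1ℚ ≤ p → (b + b) - 1ℚ ≤ q → 0ℚ ≤ p + q
      combine a b p q h h₁ h₂ = by-gap (gap h ⊕ gap h ⊕ gap h₁ ⊕ gap h₂) (solve (a ∷ b ∷ p ∷ q ∷ []) ℚ-ring)

  dropped : Fin m → Bool
  dropped e = MH e ∧ (leaf? (src e) ∨ leaf? (tgt e))

  -- Charge a dropped edge to a pruned end; a pruned vertex has degree one in `M`, so it is charged
  -- at most once.
  dropped-edges≤dropped-leaves : # dropped ≤ # (λ v → leaf? v ∧ touched v)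
  dropped-edges≤dropped-leaves = ℚ.≤-trans (Σ-mono at-leaf)
    (ℚ.≤-trans (ℚ.≤-reflexive (Σ-comm (λ e v → ⟦ leaf? v ∧ star G MH v e ⟧))) (Σ-mono at-most-one))
    where
    at-leaf : ∀ e → ⟦ dropped e ⟧ ≤ sumℚ (λ v → ⟦ leaf? v ∧ star G MH v e ⟧)
    at-leaf e = by-case (dropped e) refl
      where
      0≤term : ∀ v → 0ℚ ≤ ⟦ leaf? v ∧ star G MH v e ⟧
      0≤term v = ⟦⟧≥0 (leaf? v ∧ star G MH v e)

      end : ∀ v → leaf? v ≡ true → MH e ≡ true → incident G e v ≡ true → 1ℚ ≤ sumℚ
          (λ v → ⟦ leaf? v ∧ star G MH v e ⟧)
      end v l e∈ inc = ℚ.≤-trans (ℚ.≤-reflexive (sym (cong ⟦_⟧ (∧-intro l (∧-intro e∈ inc))))) (Σ-term 0≤term v)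

      by-case : ∀ b → dropped e ≡ b → ⟦ b ⟧ ≤ sumℚ (λ v → ⟦ leaf? v ∧ star G MH v e ⟧)
      by-case false _ = Σ-nonneg 0≤term
      by-case true  d = case ∧-true {MH e} d of λ { (e∈ , l) → case ∨-true {leaf? (src e)} l of λ
        { (inj₁ s) → end (src e) s e∈ (incident-src G e)
        ; (inj₂ t) → end (tgt e) t e∈ (incident-tgt G e) } }

    at-most-one : ∀ v → sumℚ (λ e → ⟦ leaf? v ∧ star G MH v e ⟧) ≤ ⟦ leaf? v ∧ touched v ⟧
    at-most-one v = by-leaf (leaf? v) refl
      where
      by-leaf : ∀ b → leaf? v ≡ b → sumℚ (λ e → ⟦ b ∧ star G MH v e ⟧) ≤ ⟦ b ∧ touched v ⟧
      by-leaf false _ = ℚ.≤-reflexive (Σ-zero {m} (λ _ → refl))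
      by-leaf true  l = by-touch (touched v) refl
        where
        by-touch : ∀ b → touched v ≡ b → # (star G MH v) ≤ ⟦ b ⟧
        by-touch false t = ℚ.≤-reflexive
            (Σ-zero (λ e → cong ⟦_⟧ (≢true (λ e∈ → true≢false (anyF-intro (star G MH v) e e∈) t))))
        by-touch true  _ = ℚ.≤-trans (Σ-mono
            (λ e → ⟦⟧-mono {star G MH v e} {star G M v e} (λ e∈ → case ∧-true {MH e} e∈ of λ
            { (MHe , inc) → ∧-intro (proj₁ (∧-true {M e} MHe)) inc })))
          (ℚ.≤-reflexive (trans (sym (ℕtoℚ-card (star G M v))) (cong ℕtoℚ (proj₁ (leaf-light v l)))))

  kept-vertices : # V-APX + # (λ v → leaf? v ∧ touched v) ≤ sumℚ σ
  kept-vertices = ℚ.≤-trans (ℚ.≤-reflexive (sym (Σ-+ (⟦_⟧ ∘ V-APX) (λ v → ⟦ leaf? v ∧ touched v ⟧))))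
      (Σ-mono exclusive)
    where
    table : ∀ a l t → (a ≡ true → l ≡ false) → ⟦ a ⟧ + ⟦ l ∧ t ⟧ ≤ (if t then 1ℚ else ⟦ a ⟧)
    table true  l t ex rewrite ex refl = at-most t
      where
      at-most : ∀ t → 1ℚ ≤ (if t then 1ℚ else 1ℚ)
      at-most true  = ℚ.≤-refl
      at-most false = ℚ.≤-refl
    table false true  true  _ = ℚ.≤-refl
    table false true  false _ = ℚ.≤-refl
    table false false true  _ = 0≤1
    table false false false _ = ℚ.≤-refl

    exclusive : ∀ v → ⟦ V-APX v ⟧ + ⟦ leaf? v ∧ touched v ⟧ ≤ σ v
    exclusive v = table (V-APX v) (leaf? v) (touched v) (APX-not-leaf v)

  level-sum : sumℚ (λ e → if H e then ⟦ T e ⟧ - (y e + y e) else 0ℚ)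
    ≡ (# MH - # dropped) - (sumℚ (λ e → if H e then y e else 0ℚ) + sumℚ (λ e → if H e then y e else 0ℚ))
  level-sum = trans (Σ-cong (λ e → pointwise (M e) (H e) (leaf? (src e) ∨ leaf? (tgt e)) (y e)))
    (trans (Σ-- (λ e → ⟦ MH e ⟧ - ⟦ dropped e ⟧) (λ e → yH e + yH e))
      (cong₂ _-_ (Σ-- (⟦_⟧ ∘ MH) (⟦_⟧ ∘ dropped)) (Σ-+ yH yH)))
    where
    yH : Fin m → ℚ
    yH e = if H e then y e else 0ℚ

    pointwise : ∀ a h l q → (if h then ⟦ a ∧ not (a ∧ l) ⟧ - (q + q) else 0ℚ)
      ≡ (⟦ a ∧ h ⟧ - ⟦ (a ∧ h) ∧ l ⟧) - ((if h then q else 0ℚ) + (if h then q else 0ℚ))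
    pointwise true  true  true  q = refl
    pointwise true  true  false q = refl
    pointwise true  false l     q = refl
    pointwise false true  l     q = refl
    pointwise false false l     q = refl

  level-inequality : 0ℚ ≤ ((sumℚ x + sumℚ x) - # V-APX) + sumℚ (λ e → if H e then ⟦ T e ⟧ - (y e + y e) else 0ℚ)
  level-inequality = subst (λ q → 0ℚ ≤ ((sumℚ x + sumℚ x) - # V-APX) + q) (sym level-sum)
    (bound (sumℚ x) (sumℚ (λ e → if H e then y e else 0ℚ)) (# V-APX) (# MH) (# dropped)
        (# (λ v → leaf? v ∧ touched v)) (sumℚ ρ) (sumℚ σ)
      components-bound peel-M dropped-edges≤dropped-leaves kept-vertices)
    where
    bound : ∀ X Y V E D L R S → R - E ≤ X - Y → E ≤ (R + R) - S → D ≤ L → V + L ≤ S →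
      0ℚ ≤ ((X + X) - V) + ((E - D) - (Y + Y))
    bound X Y V E D L R S p q r s = by-gap (gap p ⊕ gap p ⊕ gap q ⊕ gap r ⊕ gap s)
      (solve (X ∷ Y ∷ V ∷ E ∷ D ∷ L ∷ R ∷ S ∷ []) ℚ-ring)

-- Integration over the levels and the factor 2.

module _ (G : Graph) (w : Fin (Graph.m G) → ℚ) (w-bounds : ∀ e → 0ℚ ≤ w e × w e ≤ 1ℚ)
  (x : Fin (Graph.n G) → ℚ) (y : Fin (Graph.m G) → ℚ)
  (feasible : Feasible G w x y) (M : Fin (Graph.m G) → Bool) (mst : MSTChoice G w x y M) where
  open Graph G
  open Rounding G w x y feasible M mst

  -- The coefficient `⟦ T e ⟧ - (y e + y e)` may have either sign, so edges cannot be compared one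
  -- by one; each superlevel set of `1 - w` satisfies the inequality as a whole. The bound 1 on the
  -- levels comes from nonnegative weights.
  rounding-bound : # V-APX - sumℚ (λ e → ⟦ T e ⟧ * (1ℚ - w e)) ≤ objective G w x y + objective G w x y
  rounding-bound = bound (sumℚ x) (# V-APX) (sumℚ (λ e → ⟦ T e ⟧ * (1ℚ - w e))) (sumℚ (λ e → y e * (1ℚ - w e)))
      (sumℚ (λ e → (⟦ T e ⟧ - (y e + y e)) * (1ℚ - w e)))
      expand
      (layer-cake (λ e → ⟦ T e ⟧ - (y e + y e)) ((sumℚ x + sumℚ x) - # V-APX)
          (λ e → 1ℚ - w e) 1ℚ 0≤1 c-bounds levels)
    where
    c-bounds : ∀ e → 0ℚ ≤ 1ℚ - w e × 1ℚ - w e ≤ 1ℚ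
    c-bounds e = gap (proj₂ (w-bounds e)) , by-gap (proj₁ (w-bounds e)) (cancel (w e))
      where
      cancel : ∀ q → 1ℚ - (1ℚ - q) ≡ q
      cancel q = solve (q ∷ []) ℚ-ring

    levels : ∀ s → 0ℚ < s → 0ℚ ≤ ((sumℚ x + sumℚ x) - # V-APX)
      + sumℚ (λ e → if does (s ℚ.≤? 1ℚ - w e) then ⟦ T e ⟧ - (y e + y e) else 0ℚ)
    levels s _ = LevelSet.level-inequality G w x y feasible M mst (λ e → does (s ℚ.≤? 1ℚ - w e)) lower
      where
      lower : ∀ e f → does (s ℚ.≤? 1ℚ - w e) ≡ true → does (s ℚ.≤? 1ℚ - w f) ≡ false → w e < w f
      lower e f He Hf = ℚ.≰⇒> (λ wf≤we → fails (s ℚ.≤? 1ℚ - w f) Hf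
        (ℚ.≤-trans (holds (s ℚ.≤? 1ℚ - w e) He) (by-gap (gap wf≤we) (cancel (w e) (w f)))))
        where
        cancel : ∀ p q → (1ℚ - q) - (1ℚ - p) ≡ p - q
        cancel p q = solve (p ∷ q ∷ []) ℚ-ring

    expand : sumℚ (λ e → (⟦ T e ⟧ - (y e + y e)) * (1ℚ - w e))
      ≡ sumℚ (λ e → ⟦ T e ⟧ * (1ℚ - w e)) - (sumℚ (λ e → y e * (1ℚ - w e)) + sumℚ (λ e → y e * (1ℚ - w e)))
    expand = trans (Σ-cong (λ e → distribute ⟦ T e ⟧ (y e) (1ℚ - w e)))
      (trans (Σ-- (λ e → ⟦ T e ⟧ * (1ℚ - w e)) (λ e → y e * (1ℚ - w e) + y e * (1ℚ - w e)))
        (cong (λ q → sumℚ (λ e → ⟦ T e ⟧ * (1ℚ - w e)) - q)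
            (Σ-+ (λ e → y e * (1ℚ - w e)) (λ e → y e * (1ℚ - w e)))))
      where
      distribute : ∀ t q c → (t - (q + q)) * c ≡ t * c - (q * c + q * c)
      distribute t q c = solve (t ∷ q ∷ c ∷ []) ℚ-ring

    bound : ∀ X V t u s → s ≡ t - (u + u) → 0ℚ ≤ ((X + X) - V) * 1ℚ + s → V - t ≤ (X - u) + (X - u)
    bound X V t u s refl h = by-gap h (solve (X ∷ V ∷ t ∷ u ∷ []) ℚ-ring)

  apx-bound : ∀ b → WeightedIndex G w (APX G w x y M) b → ½ * b ≤ objective G w x y
  apx-bound b (k , comps , refl) =
    bound (# V-APX) (# T) (edgeWeight G w T) (ℕtoℚ k) (objective G w x y) (sumℚ (λ e → ⟦ T e ⟧ * (1ℚ - w e)))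
      (discounted-sum G w T)
      (components-upper G (APX G w x y M) k APX-well-formed
        (bridged⇒sparse (bridged-mono (λ e Te → proj₁ (∧-true {M e} Te)) bridged-M)) comps)
      rounding-bound
    where
    bound : ∀ V E W k O D → D ≡ E - W → k + E ≤ V → V - D ≤ O + O → ½ * (W + k) ≤ O
    bound V E W k O D refl p q = by-gap (*-nonneg (ℚ.nonNegative⁻¹ ½) (gap p ⊕ gap q))
        (solve (V ∷ E ∷ W ∷ k ∷ O ∷ []) ℚ-ring)

theorem5 : (G : Graph) (w : Fin (Graph.m G) → ℚ) →
    (∀ e → 0ℚ ≤ w e × w e ≤ 1ℚ) →
    (x : Fin (Graph.n G) → ℚ) (y : Fin (Graph.m G) → ℚ) →
    Optimal G w x y →
    (M : Fin (Graph.m G) → Bool) → MSTChoice G w x y M →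
    (OPT : Sub G) → IsMinimumForestCover G w OPT →
    (a b : ℚ) → WeightedIndex G w OPT a → WeightedIndex G w (APX G w x y M) b →
    ½ * b ≤ a
theorem5 G w w-bounds x y optimal M mst OPT (cover , _) a b opt-index apx-index =
  ℚ.≤-trans (apx-bound G w w-bounds x y (proj₁ optimal) M mst b apx-index)
            (optimal≤weighted-index G w optimal OPT a cover opt-index)
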